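{- For every simple undirected graph $G$ on $n\ge 2$ vertices, with complement $\overline{G}$, $$\alpha(G)+\alpha(\overline{G})\ge 1,$$ or equivalently, $$\beta(G)-\alpha(G)\le n-1.$$
   Context: Graphs are finite, undirected, unweighted and simple. For a graph $G$ on $n$ vertices, its Laplacian matrix is $L=D-A$, where $A$ is the adjacency matrix of $G$ and $D$ is the diagonal matrix of vertex degrees. The eigenvalues of $L$, counted with multiplicity, are denoted $0=\mu_n(G)\le\mu_{n-1}(G)\le\cdots\le\mu_1(G)$. Set $\alpha(G)=\mu_{n-1}(G)$ (the second smallest Laplacian eigenvalue, called the algebraic connectivity) and $\beta(G)=\mu_1(G)$ (the largest Laplacian eigenvalue). -}

module Defs where

open import Algebra.Apartness.Bundles using (HeytingField; HeytingCommutativeRing)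
open import Algebra.Bundles using (CommutativeRing; Semiring)
import Algebra.Definitions.RawSemiring as RawSemiringDefinitions
open import Data.Bool.Base using (if_then_else_)
open import Data.Fin.Base as Fin using (Fin; zero; suc; toℕ; fromℕ; inject₁)
import Data.Fin.Properties as Fin
open import Data.List.Base using (length; filter; allFin)
open import Data.Nat.Base as ℕ using (ℕ; zero; suc; s≤s)
open import Data.Product.Base using (∃-syntax; _×_; _,_)
open import Data.Sum.Base using (_⊎_)
open import Data.Vec.Functional using (Vector; tail; removeAt)
open import Function.Bundles using (_⇔_)
open import Level using (Level; 0ℓ; _⊔_) renaming (suc to lsuc)
open import Relation.Binary.Core using (Rel)
open import Relation.Binary.Definitions using (Symmetric; Irreflexive; Decidable)
open import Relation.Binary.PropositionalEquality.Core as ≡ using (_≡_; _≢_)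
open import Relation.Binary.Structures using (IsStrictPartialOrder)
open import Relation.Nullary.Decidable using (Dec; does; ¬?; _×-dec_)
open import Relation.Nullary.Negation using (¬_)

private
  variable
    n : ℕ

-- The real numbers, axiomatised as a Cauchy-complete Archimedean ordered
-- field.  Classically this determines ℝ up to isomorphism; the axioms are in
-- constructive form (a strict order that need not be decidable), so that
-- they also hold of the constructive real numbers.

record RealNumbers c ℓ₁ ℓ₂ : Set (lsuc (c ⊔ ℓ₁ ⊔ ℓ₂)) where
  infix 4 _<_ _≤_
  field
    heytingField : HeytingField c ℓ₁ ℓ₂

  open HeytingField heytingField public

  commutativeRing : CommutativeRing c ℓ₁
  commutativeRing = HeytingCommutativeRing.commutativeRing heytingCommutativeRing

  open RawSemiringDefinitions
    (Semiring.rawSemiring (CommutativeRing.semiring commutativeRing)) public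
    using (sum; product; _^_)
    renaming (_×_ to _·_)

  field
    _<_                  : Rel Carrier ℓ₂
    isStrictPartialOrder : IsStrictPartialOrder _≈_ _<_
    #⇔<⊎>                : ∀ x y → (x # y) ⇔ (x < y ⊎ y < x)
    +-monoˡ-<            : ∀ z {x y} → x < y → x + z < y + z
    *-pos                : ∀ {x y} → 0# < x → 0# < y → 0# < x * y
    archimedean          : ∀ x → ∃[ k ] x < k · 1#

  -- Since m and m′ are interchangeable, the Cauchy condition bounds the
  -- absolute value of the difference; k · d < 1# stands for d < 1/k.
  IsCauchy : (ℕ → Carrier) → Set ℓ₂
  IsCauchy x = ∀ k → ∃[ N ] ∀ m m′ → N ℕ.≤ m → N ℕ.≤ m′ →
    k · (x m - x m′) < 1#

  _ConvergesTo_ : (ℕ → Carrier) → Carrier → Set ℓ₂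
  x ConvergesTo l = ∀ k → ∃[ N ] ∀ m → N ℕ.≤ m →
    (k · (x m - l) < 1#) × (k · (l - x m) < 1#)

  field
    complete : ∀ x → IsCauchy x → ∃[ l ] x ConvergesTo l

  _≤_ : Rel Carrier ℓ₂
  x ≤ y = ¬ (y < x)

record Graph (n : ℕ) : Set₁ where
  infix 4 _~_ _~?_
  field
    _~_    : Rel (Fin n) 0ℓ
    _~?_   : Decidable _~_
    sym    : Symmetric _~_
    irrefl : Irreflexive _≡_ _~_

  degree : Fin n → ℕ
  degree i = length (filter (i ~?_) (allFin n))

complement : Graph n → Graph n
complement G = record
  { _~_    = λ i j → i ≢ j × ¬ (i ~ j)
  ; _~?_   = λ i j → ¬? (i Fin.≟ j) ×-dec ¬? (i ~? j)
  ; sym    = λ (i≢j , i≁j) → (λ j≡i → i≢j (≡.sym j≡i)) , (λ j~i → i≁j (sym j~i))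
  ; irrefl = λ i≡j (i≢j , _) → i≢j i≡j
  }
  where open Graph G

module Laplacian {c ℓ₁ ℓ₂} (ℝ : RealNumbers c ℓ₁ ℓ₂) where
  open RealNumbers ℝ hiding (zero)

  Matrix : ℕ → Set c
  Matrix n = Vector (Vector Carrier n) n

  -- Laplace expansion along the first row.
  det : Matrix n → Carrier
  det {zero}  M = 1#
  det {suc n} M = sum λ j →
    (- 1#) ^ toℕ j * (M zero j * det (λ i → removeAt (tail M i) j))

  indicator : ∀ {p} {P : Set p} → Dec P → Carrier
  indicator P? = if does P? then 1# else 0#

  identity : Matrix n
  identity i j = indicator (i Fin.≟ j)

  charPoly : Matrix n → Carrier → Carrier
  charPoly M x = det λ i j → x * identity i j - M i j

  adjacencyMatrix : Graph n → Matrix n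
  adjacencyMatrix G i j = indicator (i ~? j)
    where open Graph G

  degreeMatrix : Graph n → Matrix n
  degreeMatrix G i j = degree i · identity i j
    where open Graph G

  laplacian : Graph n → Matrix n
  laplacian G i j = degreeMatrix G i j - adjacencyMatrix G i j

  -- The eigenvalues with multiplicity, in non-increasing order (the
  -- eigenvalue usually written μₖ₊₁ has index k : Fin n): the roots of the
  -- characteristic polynomial.  Polynomials over the infinite field ℝ are
  -- equal when they agree at every point.  Hence the spectrum of a graph is
  -- unique up to _≈_.
  record LaplacianSpectrum (G : Graph n) : Set (c ⊔ ℓ₁ ⊔ ℓ₂) where
    field
      μ             : Vector Carrier n
      nonincreasing : ∀ {i j} → i Fin.≤ j → μ j ≤ μ i
      factorisation : ∀ x → charPoly (laplacian G) x ≈ product (λ i → x - μ i)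

  second-smallest : 2 ℕ.≤ n → Vector Carrier n → Carrier
  second-smallest (s≤s (s≤s {n = m} _)) μ = μ (inject₁ (fromℕ m))

  largest : 2 ℕ.≤ n → Vector Carrier n → Carrier
  largest (s≤s _) μ = μ zero

  module _ {G : Graph n} (2≤n : 2 ℕ.≤ n) (S : LaplacianSpectrum G) where
    open LaplacianSpectrum S

    α : Carrier
    α = second-smallest 2≤n μ

    β : Carrier
    β = largest 2≤n μ

{-# OPTIONS --safe #-}

-- Let p and q be orthogonal to the all-ones vector. The key inequality is
-- that the sum over all pairs i, j of min ((p i - p j)², (q i - q j)²) is at
-- least ∑ p² or at least ∑ q². View the vertices as points of the plane with
-- coordinates u = p + q and v = p - q, so that the minimum is (q i - q j)² or
-- (p i - p j)² according to whether u and v order i and j alike or not. Let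
-- L, R be vertices with u least and greatest, and T, B vertices with v
-- greatest and least. If two of them coincide, then some vertex is extreme in
-- both coordinates and the pairs containing it are enough. Otherwise, up to
-- the symmetries of the square, v L ≤ v R and u B - u T ≤ v R - v L, and there
-- is a number b such that the four pairs joining a vertex j to L, R, T, B
-- contribute at least (q j - b)², while the six pairs inside {L, R, T, B}
-- contribute at least the sum of (q j - b)² over these four vertices. Finally
-- ∑ (q - b)² ≥ ∑ q².
--
-- If p and q are eigenvectors of the Laplacians of G and of its complement
-- for the eigenvalues a and b, then a ∑ p² + b ∑ q² bounds the sum of the
-- minima from above. If a + b < 1, then p can be rescaled so that
-- a ∑ p² + b ∑ q² is less than both ∑ p² and ∑ q².
--
-- Eigenvectors orthogonal to the all-ones vector come from the roots of
-- det (x - L) / x, the determinant of x - L with its first row replaced by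
-- ones: adding all rows to the first one gives a row of x's. An eigenvector q
-- of G for β is an eigenvector of the complement for n - β.
module Submission where

open import Defs
open import Algebra.Apartness.Properties.HeytingCommutativeRing as Heyting using ()
open import Algebra.Bundles using (CommutativeRing)
import Algebra.Properties.Ring
import Algebra.Properties.Semiring.Mult
import Algebra.Properties.Semiring.Mult.TCOptimised
import Algebra.Properties.Semiring.Sum
import Algebra.Solver.Ring
open import Algebra.Solver.Ring.AlmostCommutativeRing
  using (fromCommutativeRing; _-Raw-AlmostCommutative⟶_)
open import Data.Bool.Base using (if_then_else_)
open import Data.Empty using (⊥)
open import Data.Fin.Base as Fin using (Fin; zero; suc; toℕ; fromℕ; inject₁; punchIn)
import Data.Fin.Properties as Fin
open import Data.Integer.Base as ℤ using (ℤ; +_; -[1+_]; _⊖_)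
import Data.Integer.Properties as ℤ
open import Data.List.Base as List using (List; []; _∷_; length; lookup; filter)
open import Data.List.Relation.Unary.All using (All; []; _∷_)
open import Data.List.Relation.Unary.AllPairs using ([]; _∷_)
open import Data.List.Relation.Unary.Unique.Propositional using (Unique)
open import Data.Maybe.Base using (Maybe; just; nothing)
open import Data.Nat.Base as ℕ using (ℕ; zero; suc; s≤s; _∸_)
import Data.Nat.Properties as ℕ
open import Data.Product.Base using (∃-syntax; _×_; _,_; proj₁; proj₂)
open import Data.Sum.Base as Sum using (_⊎_; inj₁; inj₂; [_,_]′)
open import Data.Vec.Functional using (Vector; tail; removeAt; insertAt; updateAt) renaming (_∷_ to _∷ᵛ_)
import Data.Vec.Functional.Properties as Vector
open import Function.Base using (_∘_; const; id)
open import Function.Bundles using (Equivalence)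
open import Level using (_⊔_)
open import Relation.Binary.PropositionalEquality.Core as ≡ using (_≡_; _≢_; _≗_; ≢-sym)
open import Relation.Binary.Structures using (IsStrictPartialOrder)
open import Relation.Nullary.Decidable using (Dec; yes; no; dec-true; dec-false)
open import Relation.Nullary.Negation using (¬_; contradiction)

-- Consequences of the ordered field axioms.

module OrderedField {c ℓ₁ ℓ₂} (ℝ : RealNumbers c ℓ₁ ℓ₂) where
  open RealNumbers ℝ hiding (zero) public
  open CommutativeRing commutativeRing public using (ring; semiring)
  open Algebra.Properties.Ring ring public
    using (-‿distribˡ-*; -‿distribʳ-*; -0#≈0#; -‿involutive; -‿+-comm)
  open Algebra.Properties.Semiring.Mult semiring public
    using (×1-homo-*; ×-congʳ; ×-assoc-*)
  private
    module SPO = IsStrictPartialOrder isStrictPartialOrder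
    -- With these multiples `1 × x` reduces to `x`, so `con (+ 1)` in the solver evaluates to `1#`
    -- itself.
    module M′ = Algebra.Properties.Semiring.Mult.TCOptimised semiring
  open import Relation.Binary.Reasoning.Setoid setoid

  -- Ring normalisation needs decidable coefficients: the canonical map ℤ → ℝ.
  private
    ⟦_⟧ℤ : ℤ → Carrier
    ⟦ + n ⟧ℤ      = n M′.× 1#
    ⟦ -[1+ n ] ⟧ℤ = - (suc n M′.× 1#)

    cancel-+ˡ : ∀ x y z → (x + y) - (x + z) ≈ y - z
    cancel-+ˡ x y z = begin
      (x + y) - (x + z)      ≈⟨ +-cong (+-comm x y) (sym (-‿+-comm x z)) ⟩
      (y + x) + (- x - z)    ≈⟨ +-assoc y x _ ⟩
      y + (x + (- x - z))    ≈⟨ +-congˡ (+-assoc x _ _) ⟨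
      y + ((x - x) - z)      ≈⟨ +-congˡ (+-congʳ (-‿inverseʳ x)) ⟩
      y + (0# - z)           ≈⟨ +-congˡ (+-identityˡ _) ⟩
      y - z                  ∎

    ⊖-homo : ∀ m n → ⟦ m ⊖ n ⟧ℤ ≈ m M′.× 1# - n M′.× 1#
    ⊖-homo m zero = begin
      m M′.× 1#          ≈⟨ +-identityʳ _ ⟨
      m M′.× 1# + 0#     ≈⟨ +-congˡ -0#≈0# ⟨
      m M′.× 1# - 0#     ∎
    ⊖-homo zero    (suc n) = sym (+-identityˡ _)
    ⊖-homo (suc m) (suc n) = begin
      ⟦ suc m ⊖ suc n ⟧ℤ                  ≡⟨ ≡.cong ⟦_⟧ℤ (ℤ.[1+m]⊖[1+n]≡m⊖n m n) ⟩
      ⟦ m ⊖ n ⟧ℤ                          ≈⟨ ⊖-homo m n ⟩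
      m M′.× 1# - n M′.× 1#               ≈⟨ cancel-+ˡ 1# _ _ ⟨
      (1# + m M′.× 1#) - (1# + n M′.× 1#) ≈⟨ +-cong (M′.1+× m 1#) (-‿cong (M′.1+× n 1#)) ⟨
      suc m M′.× 1# - suc n M′.× 1#       ∎

    +-homo : ∀ i j → ⟦ i ℤ.+ j ⟧ℤ ≈ ⟦ i ⟧ℤ + ⟦ j ⟧ℤ
    +-homo (+ m)    (+ n)    = M′.×-homo-+ 1# m n
    +-homo (+ m)    -[1+ n ] = ⊖-homo m (suc n)
    +-homo -[1+ m ] (+ n)    = trans (⊖-homo n (suc m)) (+-comm _ _)
    +-homo -[1+ m ] -[1+ n ] = begin
      - (suc (suc (m ℕ.+ n)) M′.× 1#)            ≡⟨ ≡.cong (λ k → - (suc k M′.× 1#)) (≡.sym (ℕ.+-suc m n)) ⟩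
      - ((suc m ℕ.+ suc n) M′.× 1#)              ≈⟨ -‿cong (M′.×-homo-+ 1# (suc m) (suc n)) ⟩
      - (suc m M′.× 1# + suc n M′.× 1#)          ≈⟨ -‿+-comm _ _ ⟨
      - (suc m M′.× 1#) - (suc n M′.× 1#)        ∎

    -homo : ∀ i → ⟦ ℤ.- i ⟧ℤ ≈ - ⟦ i ⟧ℤ
    -homo (+ zero)   = sym -0#≈0#
    -homo (+ suc n)  = refl
    -homo -[1+ n ]   = sym (-‿involutive _)

    *-homo⁺ : ∀ m j → ⟦ + m ℤ.* j ⟧ℤ ≈ ⟦ + m ⟧ℤ * ⟦ j ⟧ℤ
    *-homo⁺ m (+ n) = begin
      ⟦ + m ℤ.* + n ⟧ℤ      ≡⟨ ≡.cong ⟦_⟧ℤ (≡.sym (ℤ.pos-* m n)) ⟩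
      (m ℕ.* n) M′.× 1#     ≈⟨ M′.×1-homo-* m n ⟩
      m M′.× 1# * n M′.× 1# ∎
    *-homo⁺ m -[1+ n ] = begin
      ⟦ + m ℤ.* ℤ.- (+ suc n) ⟧ℤ       ≡⟨ ≡.cong ⟦_⟧ℤ (≡.sym (ℤ.neg-distribʳ-* (+ m) (+ suc n))) ⟩
      ⟦ ℤ.- (+ m ℤ.* + suc n) ⟧ℤ       ≈⟨ -homo (+ m ℤ.* + suc n) ⟩
      - ⟦ + m ℤ.* + suc n ⟧ℤ           ≈⟨ -‿cong (*-homo⁺ m (+ suc n)) ⟩
      - (m M′.× 1# * suc n M′.× 1#)    ≈⟨ -‿distribʳ-* _ _ ⟩
      m M′.× 1# * - (suc n M′.× 1#)    ∎

    *-homo : ∀ i j → ⟦ i ℤ.* j ⟧ℤ ≈ ⟦ i ⟧ℤ * ⟦ j ⟧ℤ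
    *-homo (+ m)    j = *-homo⁺ m j
    *-homo -[1+ m ] j = begin
      ⟦ ℤ.- (+ suc m) ℤ.* j ⟧ℤ      ≡⟨ ≡.cong ⟦_⟧ℤ (≡.sym (ℤ.neg-distribˡ-* (+ suc m) j)) ⟩
      ⟦ ℤ.- (+ suc m ℤ.* j) ⟧ℤ      ≈⟨ -homo (+ suc m ℤ.* j) ⟩
      - ⟦ + suc m ℤ.* j ⟧ℤ          ≈⟨ -‿cong (*-homo⁺ (suc m) j) ⟩
      - (suc m M′.× 1# * ⟦ j ⟧ℤ)    ≈⟨ -‿distribˡ-* _ _ ⟩
      - (suc m M′.× 1#) * ⟦ j ⟧ℤ    ∎

    ℤ⟶ℝ : ℤ.+-*-rawRing -Raw-AlmostCommutative⟶ fromCommutativeRing commutativeRing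
    ℤ⟶ℝ = record
      { ⟦_⟧    = ⟦_⟧ℤ
      ; +-homo = +-homo
      ; *-homo = *-homo
      ; -‿homo = -homo
      ; 0-homo = refl
      ; 1-homo = refl
      }

    ⟦⟧ℤ-≟ : ∀ i j → Maybe (⟦ i ⟧ℤ ≈ ⟦ j ⟧ℤ)
    ⟦⟧ℤ-≟ i j with i ℤ.≟ j
    ... | yes i≡j = just (reflexive (≡.cong ⟦_⟧ℤ i≡j))
    ... | no  _   = nothing

  open Algebra.Solver.Ring ℤ.+-*-rawRing (fromCommutativeRing commutativeRing) ℤ⟶ℝ ⟦⟧ℤ-≟ public
    using (solve; _:=_; _:+_; _:*_; :-_; _:-_; con)

  private
    variable
      w x y z r : Carrier

  open Heyting heytingCommutativeRing public using (1#0; #-congʳ; x#0y#0→xy#0; x-0≈x)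

  <-asym : x < y → ¬ (y < x)
  <-asym = SPO.asym

  <-resp-≈ : w ≈ x → y ≈ z → w < y → x < z
  <-resp-≈ w≈x y≈z w<y = SPO.<-respˡ-≈ w≈x (SPO.<-respʳ-≈ y≈z w<y)

  <⇒# : x < y → x # y
  <⇒# x<y = Equivalence.from (#⇔<⊎> _ _) (inj₁ x<y)

  >⇒# : y < x → x # y
  >⇒# y<x = Equivalence.from (#⇔<⊎> _ _) (inj₂ y<x)

  #⇒<⊎> : x # y → x < y ⊎ y < x
  #⇒<⊎> = Equivalence.to (#⇔<⊎> _ _)

  ¬#⇒≈ : ¬ (x # y) → x ≈ y
  ¬#⇒≈ = proj₁ (tight _ _)

  -- The order is not decidable, but may be treated as such in the proof of a
  -- negative statement; note that x ≤ y is one. Likewise, an existence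
  -- statement (∀ x → P x → ¬ C) → ¬ C below is the double negation of ∃ P.
  <-≤-cases : ∀ {ℓ} {C : Set ℓ} x y → (x < y → ¬ C) → (y ≤ x → ¬ C) → ¬ C
  <-≤-cases x y lt ge c = ge (λ x<y → lt x<y c) c

  ≤-cases : ∀ {ℓ} {C : Set ℓ} x y → (x ≤ y → ¬ C) → (y ≤ x → ¬ C) → ¬ C
  ≤-cases x y le ge = <-≤-cases x y (λ x<y → le (<-asym x<y)) ge

  #-≈-cases : ∀ {ℓ} {C : Set ℓ} x y → (x # y → ¬ C) → (x ≈ y → ¬ C) → ¬ C
  #-≈-cases x y ap eq c = eq (¬#⇒≈ (λ x#y → ap x#y c)) c

  <⇒≤ : x < y → x ≤ y
  <⇒≤ = <-asym

  ≤-reflexive : x ≈ y → x ≤ y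
  ≤-reflexive x≈y y<x = SPO.irrefl (sym x≈y) y<x

  ≤-refl : x ≤ x
  ≤-refl = ≤-reflexive refl

  ≤-resp-≈ : w ≈ x → y ≈ z → w ≤ y → x ≤ z
  ≤-resp-≈ w≈x y≈z w≤y z<x = w≤y (<-resp-≈ (sym y≈z) (sym w≈x) z<x)

  -- As `y ≤ z` is only the negation of `z < y`, the strict conclusion comes from cotransitivity:
  -- `z` is apart from `x` or from `y`, and every outcome but `x < z` or `y < z` contradicts
  -- `y ≤ z`.
  <-≤-trans : x < y → y ≤ z → x < z
  <-≤-trans {z = z} x<y y≤z with #-cotrans (<⇒# x<y) z
  ... | inj₁ x#z with #⇒<⊎> x#z
  ...   | inj₁ x<z = x<z
  ...   | inj₂ z<x = contradiction (SPO.trans z<x x<y) y≤z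
  <-≤-trans {z = z} x<y y≤z | inj₂ z#y with #⇒<⊎> z#y
  ...   | inj₁ z<y = contradiction z<y y≤z
  ...   | inj₂ y<z = SPO.trans x<y y<z

  ≤-<-trans : x ≤ y → y < z → x < z
  ≤-<-trans {x = x} x≤y y<z with #-cotrans (<⇒# y<z) x
  ... | inj₂ x#z with #⇒<⊎> x#z
  ...   | inj₁ x<z = x<z
  ...   | inj₂ z<x = contradiction (SPO.trans y<z z<x) x≤y
  ≤-<-trans {x = x} x≤y y<z | inj₁ y#x with #⇒<⊎> y#x
  ...   | inj₁ y<x = contradiction y<x x≤y
  ...   | inj₂ x<y = SPO.trans x<y y<z

  ≤-trans : x ≤ y → y ≤ z → x ≤ z
  ≤-trans x≤y y≤z z<x = x≤y (≤-<-trans y≤z z<x)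

  ≤-antisym : x ≤ y → y ≤ x → x ≈ y
  ≤-antisym x≤y y≤x = ¬#⇒≈ λ x#y → [ y≤x , x≤y ]′ (#⇒<⊎> x#y)

  x<y⇒0<y-x : x < y → 0# < y - x
  x<y⇒0<y-x {x} x<y = <-resp-≈ (-‿inverseʳ x) refl (+-monoˡ-< (- x) x<y)

  0<y-x⇒x<y : 0# < y - x → x < y
  0<y-x⇒x<y {y} {x} 0<y-x =
    <-resp-≈ (+-identityˡ x) (solve 2 (λ y x → y :- x :+ x := y) refl y x) (+-monoˡ-< x 0<y-x)

  +-monoˡ-≤ : ∀ z → x ≤ y → x + z ≤ y + z
  +-monoˡ-≤ {x} {y} z x≤y y+z<x+z = x≤y (<-resp-≈ (lem y) (lem x) (+-monoˡ-< (- z) y+z<x+z))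
    where
    lem : ∀ x → x + z - z ≈ x
    lem x = solve 2 (λ x z → x :+ z :- z := x) refl x z

  +-mono-≤ : w ≤ x → y ≤ z → w + y ≤ x + z
  +-mono-≤ {w} {x} {y} {z} w≤x y≤z =
    ≤-trans (+-monoˡ-≤ y w≤x) (≤-resp-≈ (+-comm y x) (+-comm z x) (+-monoˡ-≤ x y≤z))

  0≤+ : 0# ≤ x → 0# ≤ y → 0# ≤ x + y
  0≤+ 0≤x 0≤y = ≤-resp-≈ (+-identityˡ 0#) refl (+-mono-≤ 0≤x 0≤y)

  infixl 6 _⊹_
  _⊹_ : 0# ≤ x → 0# ≤ y → 0# ≤ x + y
  _⊹_ = 0≤+

  x≤y⇒0≤y-x : x ≤ y → 0# ≤ y - x
  x≤y⇒0≤y-x {x} x≤y = ≤-resp-≈ (-‿inverseʳ x) refl (+-monoˡ-≤ (- x) x≤y)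

  -- The working form of the polynomial inequalities below: the solver checks that the difference of
  -- the two sides is `r`, and `r` is certified nonnegative by a term in `_⊹_`, `_⊛_` and `0≤x²`.
  ≤-+ : y ≈ x + r → 0# ≤ r → x ≤ y
  ≤-+ {y} {x} {r} y≈x+r 0≤r =
    ≤-resp-≈ (+-identityˡ x) (trans (+-comm r x) (sym y≈x+r)) (+-monoˡ-≤ x 0≤r)

  0≤y-x⇒x≤y : 0# ≤ y - x → x ≤ y
  0≤y-x⇒x≤y {y} {x} = ≤-+ (solve 2 (λ x y → y := x :+ (y :- x)) refl x y)

  neg-mono-≤ : x ≤ y → - y ≤ - x
  neg-mono-≤ {x} {y} x≤y =
    ≤-+ (solve 2 (λ x y → :- x := :- y :+ (y :- x)) refl x y) (x≤y⇒0≤y-x x≤y)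

  0≤* : 0# ≤ x → 0# ≤ y → 0# ≤ x * y
  0≤* {x} {y} 0≤x 0≤y = <-≤-cases 0# x
    (λ 0<x → <-≤-cases 0# y
      (λ 0<y → <⇒≤ (*-pos 0<x 0<y))
      (λ y≤0 → ≤-reflexive (sym (trans (*-congˡ (≤-antisym y≤0 0≤y)) (zeroʳ x)))))
    (λ x≤0 → ≤-reflexive (sym (trans (*-congʳ (≤-antisym x≤0 0≤x)) (zeroˡ y))))

  infixl 7 _⊛_
  _⊛_ : 0# ≤ x → 0# ≤ y → 0# ≤ x * y
  _⊛_ = 0≤*

  0≤x² : ∀ x → 0# ≤ x * x
  0≤x² x = ≤-cases 0# x
    (λ 0≤x → 0≤* 0≤x 0≤x)
    (λ x≤0 → ≤-resp-≈ refl (solve 1 (λ x → (con (+ 0) :- x) :* (con (+ 0) :- x) := x :* x) refl x)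
               (0≤* (x≤y⇒0≤y-x x≤0) (x≤y⇒0≤y-x x≤0)))

  0<1 : 0# < 1#
  0<1 with #⇒<⊎> 1#0
  ... | inj₂ 0<1 = 0<1
  ... | inj₁ 1<0 = contradiction 1<0 (≤-resp-≈ refl (*-identityˡ 1#) (0≤x² 1#))

  0≤1 : 0# ≤ 1#
  0≤1 = <⇒≤ 0<1

  0≤2 : 0# ≤ 1# + 1#
  0≤2 = 0≤1 ⊹ 0≤1

  *-monoˡ-≤ : ∀ z → 0# ≤ z → x ≤ y → z * x ≤ z * y
  *-monoˡ-≤ {x} {y} z 0≤z x≤y =
    ≤-+ (solve 3 (λ x y z → z :* y := z :* x :+ z :* (y :- x)) refl x y z) (0≤z ⊛ x≤y⇒0≤y-x x≤y)

  _⁻¹⟨_⟩ : ∀ x → x # 0# → Carrier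
  x ⁻¹⟨ x#0 ⟩ = proj₁ (#⇒invertible x#0)

  *-inverse : ∀ x (x#0 : x # 0#) → x * x ⁻¹⟨ x#0 ⟩ ≈ 1#
  *-inverse x x#0 = trans (*-congʳ (sym (x-0≈x x))) (proj₂ (proj₂ (#⇒invertible x#0)))

  *-cancelˡ-0 : x # 0# → x * y ≈ 0# → y ≈ 0#
  *-cancelˡ-0 {x} {y} x#0 xy≈0 = begin
    y                        ≈⟨ *-identityʳ y ⟨
    y * 1#                   ≈⟨ *-congˡ (*-inverse x x#0) ⟨
    y * (x * x ⁻¹⟨ x#0 ⟩)    ≈⟨ solve 3 (λ x y z → y :* (x :* z) := z :* (x :* y)) refl x y _ ⟩
    x ⁻¹⟨ x#0 ⟩ * (x * y)    ≈⟨ *-congˡ xy≈0 ⟩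
    x ⁻¹⟨ x#0 ⟩ * 0#         ≈⟨ zeroʳ _ ⟩
    0#                       ∎

  ⁻¹-pos : 0# < x → (x#0 : x # 0#) → 0# < x ⁻¹⟨ x#0 ⟩
  ⁻¹-pos {x} 0<x x#0 with #⇒<⊎> inv#0
    where
    inv#0 : x ⁻¹⟨ x#0 ⟩ # 0#
    inv#0 = invertible⇒# (x , inverse)
      where
      inverse : (x * (x ⁻¹⟨ x#0 ⟩ - 0#) ≈ 1#) × ((x ⁻¹⟨ x#0 ⟩ - 0#) * x ≈ 1#)
      inverse = trans (*-congˡ (x-0≈x _)) (*-inverse x x#0)
              , trans (*-congʳ (x-0≈x _)) (trans (*-comm _ x) (*-inverse x x#0))
  ... | inj₂ 0<y = 0<y
  ... | inj₁ y<0 = contradiction 0<1 (≤-resp-≈ (*-inverse x x#0) (zeroʳ x) (*-monoˡ-≤ x (<⇒≤ 0<x) (<⇒≤ y<0)))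

  *-cancelˡ-≤ : ∀ z → 0# < z → z * x ≤ z * y → x ≤ y
  *-cancelˡ-≤ {x} {y} z 0<z zx≤zy y<x =
    zx≤zy (0<y-x⇒x<y (<-resp-≈ refl (solve 3 (λ x y z → z :* (x :- y) := z :* x :- z :* y) refl x y z)
      (*-pos 0<z (x<y⇒0<y-x y<x))))

  infix 9 _²
  _² : Carrier → Carrier
  x ² = x * x

  ²-cong : x ≈ y → x ² ≈ y ²
  ²-cong x≈y = *-cong x≈y x≈y

  [x-y]²≈[y-x]² : ∀ x y → (x - y) ² ≈ (y - x) ²
  [x-y]²≈[y-x]² = solve 2 (λ x y → (x :- y) :* (x :- y) := (y :- x) :* (y :- x)) refl

  x≈y⇒[x-y]²≈0 : x ≈ y → (x - y) ² ≈ 0#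
  x≈y⇒[x-y]²≈0 {x} {y} x≈y = trans (²-cong (trans (+-congʳ x≈y) (-‿inverseʳ y))) (zeroˡ 0#)

  closer-from-below : ∀ {a b} → a ≤ b → b ≤ x → (x - b) ² ≤ (x - a) ²
  closer-from-below {x} {a} {b} a≤b b≤x =
    ≤-+ (solve 3 (λ x a b → (x :- a) :* (x :- a) :=
          (x :- b) :* (x :- b) :+ ((b :- a) :* (b :- a) :+ (con (+ 1) :+ con (+ 1)) :* ((b :- a) :* (x :- b)))) refl x a b)
        (0≤x² (b - a) ⊹ 0≤2 ⊛ (x≤y⇒0≤y-x a≤b ⊛ x≤y⇒0≤y-x b≤x))

  closer-from-above : ∀ {a b} → x ≤ b → b ≤ a → (x - b) ² ≤ (x - a) ²
  closer-from-above {x} {a} {b} x≤b b≤a =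
    ≤-+ (solve 3 (λ x a b → (x :- a) :* (x :- a) :=
          (x :- b) :* (x :- b) :+ ((a :- b) :* (a :- b) :+ (con (+ 1) :+ con (+ 1)) :* ((a :- b) :* (b :- x)))) refl x a b)
        (0≤x² (a - b) ⊹ 0≤2 ⊛ (x≤y⇒0≤y-x b≤a ⊛ x≤y⇒0≤y-x x≤b))

  ²-between : ∀ {a b d} → a ≤ b → b ≤ d → (a - b) ² + (d - b) ² ≤ (d - a) ²
  ²-between {a} {b} {d} a≤b b≤d =
    ≤-+ (solve 3 (λ a b d → (d :- a) :* (d :- a) :=
          (a :- b) :* (a :- b) :+ (d :- b) :* (d :- b) :+ (con (+ 1) :+ con (+ 1)) :* ((b :- a) :* (d :- b))) refl a b d)
        (0≤2 ⊛ (x≤y⇒0≤y-x a≤b ⊛ x≤y⇒0≤y-x b≤d))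

  0<2 : 0# < 1# + 1#
  0<2 = <-≤-trans 0<1 (≤-+ refl 0≤1)

  double : ∀ x → (1# + 1#) * x ≈ x + x
  double x = trans (distribʳ x 1# 1#) (+-cong (*-identityˡ x) (*-identityˡ x))

  halve : ∀ x → ∃[ y ] y + y ≈ x
  halve x = 2⁻¹ * x , (begin
    2⁻¹ * x + 2⁻¹ * x      ≈⟨ double _ ⟨
    (1# + 1#) * (2⁻¹ * x)  ≈⟨ *-assoc _ _ _ ⟨
    (1# + 1#) * 2⁻¹ * x    ≈⟨ *-congʳ (*-inverse _ 2#0) ⟩
    1# * x                 ≈⟨ *-identityˡ x ⟩
    x                      ∎)
    where
    2#0 = >⇒# 0<2
    2⁻¹ = (1# + 1#) ⁻¹⟨ 2#0 ⟩

  0≤-half : (1# + 1#) * x ≈ y → 0# ≤ y → 0# ≤ x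
  0≤-half 2x≈y 0≤y = *-cancelˡ-≤ (1# + 1#) 0<2 (≤-resp-≈ (sym (zeroʳ _)) (sym 2x≈y) 0≤y)

  *-monoʳ-< : ∀ z → 0# < z → x < y → x * z < y * z
  *-monoʳ-< {x} {y} z 0<z x<y = 0<y-x⇒x<y (<-resp-≈ refl
    (solve 3 (λ x y z → (y :- x) :* z := y :* z :- x :* z) refl x y z) (*-pos (x<y⇒0<y-x x<y) 0<z))

  0≤n·1 : ∀ n → 0# ≤ n · 1#
  0≤n·1 zero    = ≤-refl
  0≤n·1 (suc n) = 0≤1 ⊹ 0≤n·1 n

  -- With a natural number `k` above `x`, take `δ = 1/(k+1)`. The successor makes the denominator at
  -- least 1 whatever the sign of `x`.
  small-reciprocal : ∀ x → ∃[ k ] ∃[ δ ] 0# < δ × δ ≤ 1# × (suc k · 1#) * δ ≈ 1# × x * δ < 1#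
  small-reciprocal x with archimedean x
  ... | k , x<k = k , δ , 0<δ , ≤-+ 1≈ (0≤n·1 k ⊛ <⇒≤ 0<δ) , *-inverse N N#0
                , <-≤-trans (*-monoʳ-< δ 0<δ x<k) (≤-+ (trans 1≈ (+-comm _ _)) (<⇒≤ 0<δ))
    where
    N = suc k · 1#
    0<N = <-≤-trans 0<1 (≤-+ refl (0≤n·1 k))
    N#0 = >⇒# 0<N
    δ = N ⁻¹⟨ N#0 ⟩
    0<δ = ⁻¹-pos 0<N N#0
    1≈ : 1# ≈ δ + k · 1# * δ
    1≈ = trans (sym (*-inverse N N#0)) (trans (distribʳ δ 1# _) (+-congʳ (*-identityˡ δ)))

-- Finite sums and the hub estimate.

module Sums {c ℓ₁ ℓ₂} (ℝ : RealNumbers c ℓ₁ ℓ₂) where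
  open OrderedField ℝ
  open Algebra.Properties.Semiring.Sum semiring public
    using (sum-cong-≋; ∑-distrib-+; ∑-comm; *-distribˡ-sum; *-distribʳ-sum; sum-remove; sum-replicate; sum-replicate-zero)
  open import Relation.Binary.Reasoning.Setoid setoid
  private
    variable
      n : ℕ

  ∑-distrib-neg : (f : Vector Carrier n) → sum (λ i → - f i) ≈ - sum f
  ∑-distrib-neg {zero}  f = sym -0#≈0#
  ∑-distrib-neg {suc n} f = trans (+-congˡ (∑-distrib-neg (f ∘ suc))) (-‿+-comm _ _)

  ∑-distrib-- : (f g : Vector Carrier n) → sum (λ i → f i - g i) ≈ sum f - sum g
  ∑-distrib-- f g = trans (∑-distrib-+ f (λ i → - g i)) (+-congˡ (∑-distrib-neg g))

  sum-zero : {f : Vector Carrier n} → (∀ i → f i ≈ 0#) → sum f ≈ 0#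
  sum-zero {n} f≈0 = trans (sum-cong-≋ f≈0) (sum-replicate-zero n)

  sum-mono-≤ : {f g : Vector Carrier n} → (∀ i → f i ≤ g i) → sum f ≤ sum g
  sum-mono-≤ {zero}  f≤g = ≤-refl
  sum-mono-≤ {suc n} f≤g = +-mono-≤ (f≤g zero) (sum-mono-≤ (f≤g ∘ suc))

  0≤sum : {f : Vector Carrier n} → (∀ i → 0# ≤ f i) → 0# ≤ sum f
  0≤sum {n} 0≤f = ≤-resp-≈ (sum-replicate-zero n) refl (sum-mono-≤ 0≤f)

  -- Zeroing the entry instead of removing it keeps the index type, so that the step can be repeated
  -- along a list of indices.
  sum-updateAt : ∀ (f : Vector Carrier n) i → sum f ≈ f i + sum (updateAt f i (const 0#))
  sum-updateAt f zero    = +-congˡ (sym (+-identityˡ _))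
  sum-updateAt f (suc i) = begin
    f zero + sum (f ∘ suc)                                     ≈⟨ +-congˡ (sum-updateAt (f ∘ suc) i) ⟩
    f zero + (f (suc i) + sum (updateAt (f ∘ suc) i (const 0#)))
      ≈⟨ solve 3 (λ x y z → x :+ (y :+ z) := y :+ (x :+ z)) refl (f zero) (f (suc i)) _ ⟩
    f (suc i) + (f zero + sum (updateAt (f ∘ suc) i (const 0#))) ∎

  -- Summing over the positions in the list makes this an ordinary `sum`, to which `∑-comm` and the
  -- distributive laws apply directly.
  sumOver : List (Fin n) → Vector Carrier n → Carrier
  sumOver xs f = sum (λ k → f (lookup xs k))

  sumOver-cong : ∀ {xs : List (Fin n)} {P : Fin n → Set} {f g : Vector Carrier n} →
                 All P xs → (∀ {i} → P i → f i ≈ g i) → sumOver xs f ≈ sumOver xs g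
  sumOver-cong []         f≈g = refl
  sumOver-cong (px ∷ pxs) f≈g = +-cong (f≈g px) (sumOver-cong pxs f≈g)

  -- Split off the entry at the head and set it to zero; the remaining indices differ from the head,
  -- so their entries are unchanged.
  sumOver-≤-sum : ∀ {xs : List (Fin n)} {f} → Unique xs → (∀ i → 0# ≤ f i) → sumOver xs f ≤ sum f
  sumOver-≤-sum []                             0≤f = 0≤sum 0≤f
  sumOver-≤-sum {xs = x ∷ xs} {f = f} (x∉ ∷ u) 0≤f =
    ≤-resp-≈ refl (sym (sum-updateAt f x))
      (+-mono-≤ ≤-refl (≤-resp-≈ (sumOver-cong x∉ unchanged) refl (sumOver-≤-sum u 0≤f′)))
    where
    f′ = updateAt f x (const 0#)
    unchanged : ∀ {y} → x ≢ y → f′ y ≈ f y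
    unchanged {y} x≢y = reflexive (Vector.updateAt-minimal y x f (x≢y ∘ ≡.sym))
    0≤f′ : ∀ i → 0# ≤ f′ i
    0≤f′ i with i Fin.≟ x
    ... | yes ≡.refl = ≤-reflexive (sym (reflexive (Vector.updateAt-updates x f)))
    ... | no i≢x     = ≤-resp-≈ refl (sym (reflexive (Vector.updateAt-minimal i x f i≢x))) (0≤f i)

  -- The pairs with a member in xs contribute 2 ∑ c to ∑ ∑ W, less the pairs
  -- inside xs, which are counted twice.
  hub-bound : (W : Fin n → Fin n → Carrier) (g : Vector Carrier n) {xs : List (Fin n)} → Unique xs →
              (∀ i j → 0# ≤ W i j) → (∀ i j → W i j ≈ W j i) →
              (∀ j → g j ≤ sumOver xs (λ x → W x j)) →
              (1# + 1#) * sumOver xs g ≤ sumOver xs (λ y → sumOver xs (λ x → W x y)) →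
              (1# + 1#) * sum g ≤ sum (λ i → sum (W i))
  hub-bound {n} W g {xs} u 0≤W W-sym g≤c 2g≤c = ≤-+ (begin
      sum row
        ≈⟨ solve 5 (λ w s t h g → let two = con (+ 1) :+ con (+ 1) in
             w := two :* g :+ ((w :- s :- (s :- t)) :+ two :* (s :- g :- (t :- h)) :+ (t :- two :* h)))
             refl (sum row) (sum col) (sumOver xs col) (sumOver xs g) (sum g) ⟩
      (1# + 1#) * sum g + _ ∎)
    ((x≤y⇒0≤y-x outside) ⊹ (0≤2 ⊛ x≤y⇒0≤y-x slack) ⊹ x≤y⇒0≤y-x 2g≤c)
    where
    row col : Vector Carrier n
    row i = sum (W i)
    col j = sumOver xs (λ x → W x j)
    c≤row : ∀ i → col i ≤ row i
    c≤row i = ≤-resp-≈ (sum-cong-≋ (λ k → W-sym i (lookup xs k))) refl (sumOver-≤-sum {f = W i} u (0≤W i))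
    -- The terms `row i - col i` are nonnegative. Over `xs` they add up to the left side, because
    -- the rows of `xs` add up to the vector `col`.
    outside : sum col - sumOver xs col ≤ sum row - sum col
    outside = ≤-resp-≈
      (trans (∑-distrib-- {length xs} _ _) (+-congʳ (∑-comm {length xs} (λ k → W (lookup xs k)))))
      (∑-distrib-- row col)
      (sumOver-≤-sum {f = λ i → row i - col i} u (x≤y⇒0≤y-x ∘ c≤row))
    slack : sumOver xs col - sumOver xs g ≤ sum col - sum g
    slack = ≤-resp-≈ (∑-distrib-- {length xs} _ _) (∑-distrib-- col g)
      (sumOver-≤-sum {f = λ i → col i - g i} u (x≤y⇒0≤y-x ∘ g≤c))

-- Inequalities between sums of squares.

module QuadraticInequalities {c ℓ₁ ℓ₂} (ℝ : RealNumbers c ℓ₁ ℓ₂) where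
  open OrderedField ℝ
  open import Relation.Binary.Reasoning.Setoid setoid

  2# 4# : Carrier
  2# = 1# + 1#
  4# = 2# + 2#

  0≤4 : 0# ≤ 4#
  0≤4 = 0≤2 ⊹ 0≤2

  -- Either alternative gives `4xy ≤ d²` for nonnegative `x` and `y`, the second by the inequality
  -- of arithmetic and geometric means. The linear form is kept because `hub-pairs` uses it
  -- directly.
  Paired : Carrier → Carrier → Carrier → Set _
  Paired x y d = x * y ≈ 0# ⊎ x + y ≤ d

  drop-zero : ∀ {x y z} → y ≈ 0# → x + z * y ≈ x
  drop-zero y≈0 = trans (+-congˡ (trans (*-congˡ y≈0) (zeroʳ _))) (+-identityʳ _)

  paired⇒4xy≤d² : ∀ {x y d} → 0# ≤ x → 0# ≤ y → Paired x y d → 4# * (x * y) ≤ d ²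
  paired⇒4xy≤d² {x} {y} {d} 0≤x 0≤y (inj₁ xy≈0) =
    ≤-resp-≈ (sym (trans (*-congˡ xy≈0) (zeroʳ 4#))) refl (0≤x² d)
  paired⇒4xy≤d² {x} {y} {d} 0≤x 0≤y (inj₂ x+y≤d) =
    ≤-+ (solve 3 (λ x y d → let s = d :- (x :+ y) ; two = con (+ 1) :+ con (+ 1) in
          d :* d := (two :+ two) :* (x :* y) :+ ((x :- y) :* (x :- y) :+ s :* s :+ two :* (s :* (x :+ y)))) refl x y d)
        (0≤x² (x - y) ⊹ 0≤x² _ ⊹ 0≤2 ⊛ (x≤y⇒0≤y-x x+y≤d ⊛ (0≤x ⊹ 0≤y)))

  -- The terms in `y` are together at least `(t - s)²/2`, hence at least `2(r - b)(e - b)`. Adding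
  -- this to `(x - r)² + (x - e)²` gives `(x - b)²` plus the square of
  -- `(x - b) - (r - b) - (e - b)`.
  corner : ∀ x b r e s t y → 4# * ((r - b) * (e - b)) ≤ (t - s) ² →
           (x - b) ² ≤ ((y - s) ² + (x - r) ²) + ((y - t) ² + (x - e) ²)
  corner x b r e s t y h = *-cancelˡ-≤ 2# 0<2
    (≤-+ (solve 7 (λ x b r e s t y → let two = con (+ 1) :+ con (+ 1) ; sq = λ z → z :* z in
           two :* (sq (y :- s) :+ sq (x :- r) :+ (sq (y :- t) :+ sq (x :- e)))
           := two :* sq (x :- b) :+ (sq (y :- s :+ (y :- t)) :+ two :* sq (x :- r :+ (b :- e))
                :+ (sq (t :- s) :- (two :+ two) :* ((r :- b) :* (e :- b)))))
           refl x b r e s t y)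
         (0≤x² (y - s + (y - t)) ⊹ 0≤2 ⊛ 0≤x² _ ⊹ x≤y⇒0≤y-x h))

  -- As in `corner`, but without `(x - e)²`: now `(x - r)² + 2(r - b)(e - b)` is
  -- `(x - b)² + (r - b)² + 2(r - b)(e - x)`.
  corner′ : ∀ x b r e s t y → 4# * ((r - b) * (e - b)) ≤ (t - s) ² → 0# ≤ (r - b) * (e - x) →
            (x - b) ² ≤ ((y - s) ² + (x - r) ²) + (y - t) ²
  corner′ x b r e s t y h h′ = *-cancelˡ-≤ 2# 0<2
    (≤-+ (solve 7 (λ x b r e s t y → let two = con (+ 1) :+ con (+ 1) ; sq = λ z → z :* z in
           two :* (sq (y :- s) :+ sq (x :- r) :+ sq (y :- t))
           := two :* sq (x :- b) :+ (sq (y :- s :+ (y :- t)) :+ two :* sq (r :- b)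
                :+ (two :+ two) :* ((r :- b) :* (e :- x))
                :+ (sq (t :- s) :- (two :+ two) :* ((r :- b) :* (e :- b)))))
           refl x b r e s t y)
         (0≤x² (y - s + (y - t)) ⊹ 0≤2 ⊛ 0≤x² (r - b) ⊹ 0≤4 ⊛ h′ ⊹ x≤y⇒0≤y-x h))

  -- Here `l r t e` are the values of `q` at L, R, T, B, and `pl pr pt pe` those of `p`. The sum
  -- `(t - l)² + (e - r)²` falls short of the left side by `2(b - l)(b - t) + 2(r - b)(e - b)`. Each
  -- product is zero or is absorbed by completing squares in differences of `p`, using the linear
  -- bound.
  hub-pairs : ∀ b l r t e pl pr pt pe → l ≤ b → b ≤ r →
    Paired (b - l) (b - t) (pr - pe) → Paired (r - b) (e - b) (pt - pl) →
    (l - b) ² + (r - b) ² + ((t - b) ² + (e - b) ²) ≤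
    (r - l) ² + (pe - pt) ² + ((t - l) ² + (e - r) ²) + ((pe - pl) ² + (pt - pr) ²)
  hub-pairs b l r t e pl pr pt pe l≤b b≤r (inj₁ k) (inj₁ k′) =
    ≤-+ (trans (solve 9 (λ b l r t e pl pr pt pe → let two = con (+ 1) :+ con (+ 1) ; sq = λ z → z :* z in
           sq (r :- l) :+ sq (pe :- pt) :+ (sq (t :- l) :+ sq (e :- r)) :+ (sq (pe :- pl) :+ sq (pt :- pr))
           := sq (l :- b) :+ sq (r :- b) :+ (sq (t :- b) :+ sq (e :- b))
              :+ (sq (r :- l) :+ sq (pe :- pt) :+ (sq (pe :- pl) :+ sq (pt :- pr)))
              :+ :- two :* ((b :- l) :* (b :- t)) :+ :- two :* ((r :- b) :* (e :- b)))
           refl b l r t e pl pr pt pe)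
         (trans (drop-zero k′) (drop-zero k)))
        (0≤x² (r - l) ⊹ 0≤x² (pe - pt) ⊹ (0≤x² (pe - pl) ⊹ 0≤x² (pt - pr)))
  hub-pairs b l r t e pl pr pt pe l≤b b≤r (inj₁ k) (inj₂ k′) =
    ≤-+ (trans (solve 9 (λ b l r t e pl pr pt pe → let two = con (+ 1) :+ con (+ 1) ; sq = λ z → z :* z in
           sq (r :- l) :+ sq (pe :- pt) :+ (sq (t :- l) :+ sq (e :- r)) :+ (sq (pe :- pl) :+ sq (pt :- pr))
           := sq (l :- b) :+ sq (r :- b) :+ (sq (t :- b) :+ sq (e :- b))
              :+ (sq (pt :- pe :- (r :- b)) :+ sq (pe :- pl :- (r :- b)) :+ sq (pt :- pr) :+ sq (r :- l)
                  :+ two :* ((r :- b) :* (pt :- pl :- (r :- b :+ (e :- b)))))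
              :+ :- two :* ((b :- l) :* (b :- t)))
           refl b l r t e pl pr pt pe)
         (drop-zero k))
        (0≤x² (pt - pe - (r - b)) ⊹ 0≤x² (pe - pl - (r - b)) ⊹ 0≤x² (pt - pr) ⊹ 0≤x² (r - l)
         ⊹ 0≤2 ⊛ (x≤y⇒0≤y-x b≤r ⊛ x≤y⇒0≤y-x k′))
  hub-pairs b l r t e pl pr pt pe l≤b b≤r (inj₂ k) (inj₁ k′) =
    ≤-+ (trans (solve 9 (λ b l r t e pl pr pt pe → let two = con (+ 1) :+ con (+ 1) ; sq = λ z → z :* z in
           sq (r :- l) :+ sq (pe :- pt) :+ (sq (t :- l) :+ sq (e :- r)) :+ (sq (pe :- pl) :+ sq (pt :- pr))
           := sq (l :- b) :+ sq (r :- b) :+ (sq (t :- b) :+ sq (e :- b))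
              :+ (sq (pt :- pe :- (b :- l)) :+ sq (pr :- pt :- (b :- l)) :+ sq (pe :- pl) :+ sq (r :- l)
                  :+ two :* ((b :- l) :* (pr :- pe :- (b :- l :+ (b :- t)))))
              :+ :- two :* ((r :- b) :* (e :- b)))
           refl b l r t e pl pr pt pe)
         (drop-zero k′))
        (0≤x² (pt - pe - (b - l)) ⊹ 0≤x² (pr - pt - (b - l)) ⊹ 0≤x² (pe - pl) ⊹ 0≤x² (r - l)
         ⊹ 0≤2 ⊛ (x≤y⇒0≤y-x l≤b ⊛ x≤y⇒0≤y-x k))
  hub-pairs b l r t e pl pr pt pe l≤b b≤r (inj₂ k) (inj₂ k′) =
    ≤-+ (solve 9 (λ b l r t e pl pr pt pe → let two = con (+ 1) :+ con (+ 1) ; sq = λ z → z :* z in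
           sq (r :- l) :+ sq (pe :- pt) :+ (sq (t :- l) :+ sq (e :- r)) :+ (sq (pe :- pl) :+ sq (pt :- pr))
           := sq (l :- b) :+ sq (r :- b) :+ (sq (t :- b) :+ sq (e :- b))
              :+ (sq (pr :- pt :- (b :- l)) :+ sq (pe :- pl :- (r :- b)) :+ sq (pt :- pe :- (r :- l))
                  :+ sq (b :- l) :+ sq (r :- b)
                  :+ two :* ((b :- l) :* (pr :- pe :- (b :- l :+ (b :- t))))
                  :+ two :* ((r :- b) :* (pt :- pl :- (r :- b :+ (e :- b))))))
           refl b l r t e pl pr pt pe)
        (0≤x² (pr - pt - (b - l)) ⊹ 0≤x² (pe - pl - (r - b)) ⊹ 0≤x² (pt - pe - (r - l))
         ⊹ 0≤x² (b - l) ⊹ 0≤x² (r - b)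
         ⊹ 0≤2 ⊛ (x≤y⇒0≤y-x l≤b ⊛ x≤y⇒0≤y-x k) ⊹ 0≤2 ⊛ (x≤y⇒0≤y-x b≤r ⊛ x≤y⇒0≤y-x k′))

-- Concordant pairs and the bound from hubs.

module HubBounds {c ℓ₁ ℓ₂} (ℝ : RealNumbers c ℓ₁ ℓ₂) where
  open OrderedField ℝ
  open Sums ℝ
  open QuadraticInequalities ℝ
  open import Relation.Binary.Reasoning.Setoid setoid

  -- A symmetric nonnegative matrix that lies above the minimum of the two squares; the disjunction
  -- `edge` says so without forming the minimum.
  record Dominates {n} (W : Fin n → Fin n → Carrier) (p q : Vector Carrier n) : Set (c ⊔ ℓ₁ ⊔ ℓ₂) where
    field
      nonneg : ∀ i j → 0# ≤ W i j
      symm   : ∀ i j → W i j ≈ W j i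
      edge   : ∀ i j → (p j - p i) ² ≤ W i j ⊎ (q j - q i) ² ≤ W i j

    -- The pair i, j is concordant if u and v order it in the same way, which
    -- means that |Δq| ≤ |Δp|, since Δp² - Δq² = Δu Δv.
    u v : Vector Carrier n
    u i = p i + q i
    v i = p i - q i

    concordant : ∀ i j → 0# ≤ (u j - u i) * (v j - v i) → (q j - q i) ² ≤ W i j
    concordant i j 0≤ΔuΔv with edge i j
    ... | inj₂ Δq²≤W = Δq²≤W
    ... | inj₁ Δp²≤W = ≤-trans
      (≤-+ (solve 4 (λ a b x y → (a :- b) :* (a :- b) := (x :- y) :* (x :- y) :+
              (a :+ x :- (b :+ y)) :* (a :- x :- (b :- y))) refl (p j) (p i) (q j) (q i)) 0≤ΔuΔv)
      Δp²≤W

    discordant : ∀ i j → 0# ≤ (u j - u i) * (v i - v j) → (p j - p i) ² ≤ W i j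
    discordant i j 0≤ΔuΔv with edge i j
    ... | inj₁ Δp²≤W = Δp²≤W
    ... | inj₂ Δq²≤W = ≤-trans
      (≤-+ (solve 4 (λ a b x y → (x :- y) :* (x :- y) := (a :- b) :* (a :- b) :+
              (a :+ x :- (b :+ y)) :* (b :- y :- (a :- x))) refl (p j) (p i) (q j) (q i)) 0≤ΔuΔv)
      Δq²≤W

    flip : ∀ {x i j} → x ≤ W i j → x ≤ W j i
    flip x≤W = ≤-resp-≈ refl (symm _ _) x≤W

    -- The arrow shows the direction from `i` to `j` in the plane with coordinates `u` and `v`: `↗`
    -- and `↙` join concordant pairs, `↘` and `↖` discordant ones.
    ↗ : ∀ {i j} → u i ≤ u j → v i ≤ v j → (q j - q i) ² ≤ W i j
    ↗ ui≤uj vi≤vj = concordant _ _ (x≤y⇒0≤y-x ui≤uj ⊛ x≤y⇒0≤y-x vi≤vj)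

    ↙ : ∀ {i j} → u j ≤ u i → v j ≤ v i → (q j - q i) ² ≤ W i j
    ↙ uj≤ui vj≤vi = flip (≤-resp-≈ ([x-y]²≈[y-x]² _ _) refl (↗ uj≤ui vj≤vi))

    ↘ : ∀ {i j} → u i ≤ u j → v j ≤ v i → (p j - p i) ² ≤ W i j
    ↘ ui≤uj vj≤vi = discordant _ _ (x≤y⇒0≤y-x ui≤uj ⊛ x≤y⇒0≤y-x vj≤vi)

    ↖ : ∀ {i j} → u j ≤ u i → v i ≤ v j → (p j - p i) ² ≤ W i j
    ↖ uj≤ui vi≤vj = flip (≤-resp-≈ ([x-y]²≈[y-x]² _ _) refl (↘ uj≤ui vi≤vj))

    -- Because `2q = u - v`.
    q-mono : ∀ {i j} → u i ≤ u j → v j ≤ v i → q i ≤ q j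
    q-mono {i} {j} ui≤uj vj≤vi = *-cancelˡ-≤ 2# 0<2
      (≤-+ (solve 4 (λ a b x y → (con (+ 1) :+ con (+ 1)) :* x :=
              (con (+ 1) :+ con (+ 1)) :* y :+ ((a :+ x :- (b :+ y)) :+ (b :- y :- (a :- x)))) refl (p j) (p i) (q j) (q i))
           (x≤y⇒0≤y-x ui≤uj ⊹ x≤y⇒0≤y-x vj≤vi))

  open Dominates

  ∑² : ∀ {n} → Vector Carrier n → Carrier
  ∑² f = sum (λ i → f i ²)

  -- The difference of the two sides is `n b² - 2b ∑ f`, where the last sum vanishes.
  ∑²-shift-≤ : ∀ {n} (f : Vector Carrier n) b → sum f ≈ 0# → ∑² f ≤ sum (λ i → (f i - b) ²)
  ∑²-shift-≤ {n} f b ∑f≈0 = ≤-+ (begin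
      sum (λ i → (f i - b) ²)
        ≈⟨ sum-cong-≋ (λ i → solve 2 (λ x b → (x :- b) :* (x :- b) := x :* x :+ (b :* b :- (b :+ b) :* x)) refl (f i) b) ⟩
      sum (λ i → f i ² + (b ² - (b + b) * f i))
        ≈⟨ ∑-distrib-+ {n} _ _ ⟩
      ∑² f + sum (λ i → b ² - (b + b) * f i)
        ≈⟨ +-congˡ (∑-distrib-- {n} _ _) ⟩
      ∑² f + (sum {n} (λ _ → b ²) - sum (λ i → (b + b) * f i))
        ≈⟨ +-congˡ (+-congˡ (-‿cong (*-distribˡ-sum (b + b) f))) ⟨
      ∑² f + (sum {n} (λ _ → b ²) - (b + b) * sum f)
        ≈⟨ +-congˡ (+-congˡ (-‿cong (trans (*-congˡ ∑f≈0) (zeroʳ _)))) ⟩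
      ∑² f + (sum {n} (λ _ → b ²) - 0#)
        ≈⟨ +-congˡ (x-0≈x _) ⟩
      ∑² f + sum {n} (λ _ → b ²) ∎)
    (0≤sum {n} (λ _ → 0≤x² b))

  -- The factor 2 accounts for the double sum, in which every pair occurs in both orders.
  Bound : ∀ {n} → (Fin n → Fin n → Carrier) → Vector Carrier n → Set _
  Bound W f = 2# * ∑² f ≤ sum (λ i → sum (W i))

  -- The bound for four distinct extreme vertices.

  module AtHubs {n} {W : Fin n → Fin n → Carrier} {p q : Vector Carrier n} (D : Dominates W p q)
    (∑q≈0 : sum q ≈ 0#) {L R T B : Fin n} (distinct : Unique (L ∷ R ∷ T ∷ B ∷ []))
    (L-min : ∀ j → u D L ≤ u D j) (R-max : ∀ j → u D j ≤ u D R)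
    (T-max : ∀ j → v D j ≤ v D T) (B-min : ∀ j → v D B ≤ v D j)
    (σ : v D L ≤ v D R) (σ+τ : 0# ≤ (v D R - v D L) + (u D T - u D B))
    where

    private
      module D = Dominates D

      cost : Fin n → Carrier
      cost j = (W L j + W R j) + (W T j + W B j)

      pairs : Carrier
      pairs = W L R + W T B + (W L T + W R B) + (W L B + W R T)

    -- `hub-bound` with `(q - b)²` as the share of each vertex, followed by `∑²-shift-≤`. In the
    -- double sum over the hubs each of the six pairs occurs twice, and the diagonal is dropped as
    -- nonnegative.
    suffices : ∀ b → (∀ j → (q j - b) ² ≤ cost j) →
               (q L - b) ² + (q R - b) ² + ((q T - b) ² + (q B - b) ²) ≤ pairs → Bound W q
    suffices b g≤cost g≤pairs = ≤-trans (*-monoˡ-≤ 2# 0≤2 (∑²-shift-≤ q b ∑q≈0))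
      (hub-bound W g distinct D.nonneg D.symm
        (λ j → ≤-resp-≈ refl
          (solve 4 (λ a b c d → a :+ b :+ (c :+ d) := a :+ (b :+ (c :+ (d :+ con (+ 0))))) refl _ _ _ _) (g≤cost j))
        (≤-+ (begin
          _ ≈⟨ +-cong (+-congˡ (+-cong (D.symm R L) (+-cong (D.symm T L) (+-congʳ (D.symm B L)))))
                (+-cong (+-congˡ (+-congˡ (+-cong (D.symm T R) (+-congʳ (D.symm B R)))))
                  (+-congʳ (+-congˡ (+-congˡ (+-congˡ (+-congʳ (D.symm B T))))))) ⟩
          _ ≈⟨ solve 14 (λ ll rr tt bb lr lt lb rt rb tb gl gr gt gb → let two = con (+ 1) :+ con (+ 1) ; o = con (+ 0) in
                 (ll :+ (lr :+ (lt :+ (lb :+ o)))) :+ ((lr :+ (rr :+ (rt :+ (rb :+ o)))) :+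
                 ((lt :+ (rt :+ (tt :+ (tb :+ o)))) :+ ((lb :+ (rb :+ (tb :+ (bb :+ o)))) :+ o)))
                 := two :* (gl :+ (gr :+ (gt :+ (gb :+ o)))) :+
                   (two :* (lr :+ tb :+ (lt :+ rb) :+ (lb :+ rt) :- (gl :+ gr :+ (gt :+ gb))) :+ (ll :+ rr :+ (tt :+ bb))))
                 refl (W L L) (W R R) (W T T) (W B B) (W L R) (W L T) (W L B) (W R T) (W R B) (W T B) (g L) (g R) (g T) (g B) ⟩
          _ ∎)
          (0≤2 ⊛ x≤y⇒0≤y-x g≤pairs ⊹ (D.nonneg L L ⊹ D.nonneg R R ⊹ (D.nonneg T T ⊹ D.nonneg B B)))))
      where
      g : Vector Carrier n
      g j = (q j - b) ²

    private
      left : ∀ {j x} → x ≤ W L j + W R j → x ≤ cost j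
      left x≤ = ≤-trans x≤ (≤-+ refl (D.nonneg T _ ⊹ D.nonneg B _))

      right : ∀ {j x} → x ≤ W T j + W B j → x ≤ cost j
      right x≤ = ≤-trans x≤ (≤-+ (+-comm _ _) (D.nonneg L _ ⊹ D.nonneg R _))

      on-L : ∀ {j x} → x ≤ W L j → x ≤ W L j + W R j
      on-L x≤ = ≤-trans x≤ (≤-+ refl (D.nonneg R _))

      on-R : ∀ {j x} → x ≤ W R j → x ≤ W L j + W R j
      on-R x≤ = ≤-trans x≤ (≤-+ (+-comm _ _) (D.nonneg L _))

      on-T : ∀ {j x} → x ≤ W T j → x ≤ W T j + W B j
      on-T x≤ = ≤-trans x≤ (≤-+ refl (D.nonneg B _))

      on-B : ∀ {j x} → x ≤ W B j → x ≤ W T j + W B j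
      on-B x≤ = ≤-trans x≤ (≤-+ (+-comm _ _) (D.nonneg T _))

      square-zero : ∀ {x y z} → x ≈ y → 0# ≤ z → (x - y) ² ≤ z
      square-zero x≈y 0≤z = ≤-resp-≈ (sym (x≈y⇒[x-y]²≈0 x≈y)) refl 0≤z

    -- Take `b = q R`. A vertex `j` with `v j ≤ v R` is concordant with R. Any other has
    -- `q j ≤ q R ≤ q L` and is concordant with L, whose value of `q` is at least as far from `q j`
    -- as `b` is.
    qR≤qL⇒Bound : q R ≤ q L → Bound W q
    qR≤qL⇒Bound qR≤qL = suffices (q R) (left ∘ at) (≤-+ (solve 10
        (λ lr tb lt rb lb rt gl gr gt gb → lr :+ tb :+ (lt :+ rb) :+ (lb :+ rt) :=
          gl :+ gr :+ (gt :+ gb) :+ ((lr :- (gl :+ gr)) :+ (lt :+ rt :- gt) :+ (lb :+ rb :- gb) :+ tb))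
        refl (W L R) (W T B) (W L T) (W R B) (W L B) (W R T) _ _ _ _)
        (x≤y⇒0≤y-x LR ⊹ x≤y⇒0≤y-x (at T) ⊹ x≤y⇒0≤y-x (at B) ⊹ D.nonneg T B))
      where
      at : ∀ j → (q j - q R) ² ≤ W L j + W R j
      at j = ≤-cases (D.v j) (D.v R)
        (λ vj≤vR → on-R (D.↙ (R-max j) vj≤vR))
        (λ vR≤vj → on-L (≤-trans (closer-from-above (D.q-mono (R-max j) vR≤vj) qR≤qL) (D.↗ (L-min j) (≤-trans σ vR≤vj))))
      LR : (q L - q R) ² + (q R - q R) ² ≤ W L R
      LR = ≤-trans
        (≤-reflexive (solve 2 (λ a b → (a :- b) :* (a :- b) :+ (b :- b) :* (b :- b) := (b :- a) :* (b :- a)) refl (q L) (q R)))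
        (D.↗ (L-min R) σ)

    -- Take `b = q B`. If `u B ≤ u j`, then `j` is concordant with B. Otherwise `q j ≤ q B ≤ q T`,
    -- and either `j` is concordant with T or `u T ≤ u j`, which forces `q j = q B`.
    qB≤qT⇒Bound : q B ≤ q T → Bound W q
    qB≤qT⇒Bound qB≤qT = suffices (q B) (right ∘ at) (≤-+ (solve 10
        (λ lr tb lt rb lb rt gl gr gt gb → lr :+ tb :+ (lt :+ rb) :+ (lb :+ rt) :=
          gl :+ gr :+ (gt :+ gb) :+ ((tb :- (gt :+ gb)) :+ (lt :+ lb :- gl) :+ (rt :+ rb :- gr) :+ lr))
        refl (W L R) (W T B) (W L T) (W R B) (W L B) (W R T) _ _ _ _)
        (x≤y⇒0≤y-x TB
         ⊹ x≤y⇒0≤y-x (≤-resp-≈ refl (+-cong (D.symm T L) (D.symm B L)) (at L))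
         ⊹ x≤y⇒0≤y-x (≤-resp-≈ refl (+-cong (D.symm T R) (D.symm B R)) (at R)) ⊹ D.nonneg L R))
      where
      at : ∀ j → (q j - q B) ² ≤ W T j + W B j
      at j = ≤-cases (D.u j) (D.u B)
        (λ uj≤uB → on-T (≤-cases (D.u j) (D.u T)
          (λ uj≤uT → ≤-trans (closer-from-above (D.q-mono uj≤uB (B-min j)) qB≤qT) (D.↙ uj≤uT (T-max j)))
          (λ uT≤uj → square-zero
            (≤-antisym (D.q-mono uj≤uB (B-min j)) (≤-trans qB≤qT (D.q-mono uT≤uj (T-max j))))
            (D.nonneg T j))))
        (λ uB≤uj → on-B (D.↗ uB≤uj (B-min j)))
      TB : (q T - q B) ² + (q B - q B) ² ≤ W T B
      TB = ≤-resp-≈ (sym (trans (+-congˡ (x≈y⇒[x-y]²≈0 refl)) (+-identityʳ _))) refl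
        (≤-cases (D.u B) (D.u T)
          (λ uB≤uT → ≤-resp-≈ ([x-y]²≈[y-x]² _ _) refl (D.↙ uB≤uT (T-max B)))
          (λ uT≤uB → square-zero (≤-antisym (D.q-mono uT≤uB (T-max B)) qB≤qT) (D.nonneg T B)))

    module _ (b : Carrier) (qL≤b : q L ≤ b) (qT≤b : q T ≤ b) (b≤qR : b ≤ q R) (b≤qB : b ≤ q B)
      (LT : Paired (b - q L) (b - q T) (p R - p B)) (RB : Paired (q R - b) (q B - b) (p T - p L))
      where

      private
        RB′ : 4# * ((q R - b) * (q B - b)) ≤ (p T - p L) ²
        RB′ = paired⇒4xy≤d² (x≤y⇒0≤y-x b≤qR) (x≤y⇒0≤y-x b≤qB) RB

        LT′ : 4# * ((q L - b) * (q T - b)) ≤ (p R - p B) ²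
        LT′ = ≤-resp-≈ (*-congˡ (solve 3 (λ b l t → (b :- l) :* (b :- t) := (l :- b) :* (t :- b)) refl b (q L) (q T))) refl
          (paired⇒4xy≤d² (x≤y⇒0≤y-x qL≤b) (x≤y⇒0≤y-x qT≤b) LT)

        swap : ∀ {j x} → x ≤ (W B j + W L j) + (W R j + W T j) → x ≤ cost j
        swap = ≤-resp-≈ refl (solve 4 (λ l r t b → b :+ l :+ (r :+ t) := l :+ r :+ (t :+ b)) refl _ _ _ _)

        -- For `b ≤ q j`, one pair is enough if `j` is concordant with L or T. Otherwise `j` is
        -- below L and to the right of T, so its pairs with L and T cost `Δp²` and its pair with R
        -- costs `Δq²`; the pair with B costs `Δq²` in `corner`, while in `corner′` it is discarded
        -- thanks to `q j ≤ q B`. The case `q j ≤ b` is the half turn of this one.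
        at : ∀ j → (q j - b) ² ≤ cost j
        at j = ≤-cases b (q j)
          (λ b≤qj → ≤-cases (D.v L) (D.v j)
            (λ vL≤vj → left (on-L (≤-trans (closer-from-below qL≤b b≤qj) (D.↗ (L-min j) vL≤vj))))
            (λ vj≤vL → ≤-cases (D.u j) (D.u T)
              (λ uj≤uT → right (on-T (≤-trans (closer-from-below qT≤b b≤qj) (D.↙ uj≤uT (T-max j)))))
              (λ uT≤uj → ≤-cases (D.u j) (D.u B)
                (λ uj≤uB → ≤-trans
                  (corner′ (q j) b (q R) (q B) (p L) (p T) (p j) RB′
                    (x≤y⇒0≤y-x b≤qR ⊛ x≤y⇒0≤y-x (D.q-mono uj≤uB (B-min j))))
                  (+-mono-≤ (+-mono-≤ (D.↘ (L-min j) vj≤vL) (D.↙ (R-max j) (≤-trans vj≤vL σ)))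
                    (on-T (D.↘ uT≤uj (T-max j)))))
                (λ uB≤uj → ≤-trans
                  (corner (q j) b (q R) (q B) (p L) (p T) (p j) RB′)
                  (+-mono-≤ (+-mono-≤ (D.↘ (L-min j) vj≤vL) (D.↙ (R-max j) (≤-trans vj≤vL σ)))
                    (+-mono-≤ (D.↘ uT≤uj (T-max j)) (D.↗ uB≤uj (B-min j))))))))
          (λ qj≤b → ≤-cases (D.v j) (D.v R)
            (λ vj≤vR → left (on-R (≤-trans (closer-from-above qj≤b b≤qR) (D.↙ (R-max j) vj≤vR))))
            (λ vR≤vj → ≤-cases (D.u B) (D.u j)
              (λ uB≤uj → right (on-B (≤-trans (closer-from-above qj≤b b≤qB) (D.↗ uB≤uj (B-min j)))))
              (λ uj≤uB → swap (≤-cases (D.u T) (D.u j)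
                (λ uT≤uj → ≤-trans
                  (corner′ (q j) b (q L) (q T) (p B) (p R) (p j) LT′
                    (≤-resp-≈ refl (solve 4 (λ b l t x → (b :- l) :* (x :- t) := (l :- b) :* (t :- x)) refl b (q L) (q T) (q j))
                      (x≤y⇒0≤y-x qL≤b ⊛ x≤y⇒0≤y-x (D.q-mono uT≤uj (T-max j)))))
                  (+-mono-≤ (+-mono-≤ (D.↖ uj≤uB (B-min j)) (D.↗ (L-min j) (≤-trans σ vR≤vj)))
                    (≤-trans (D.↖ (R-max j) vR≤vj) (≤-+ refl (D.nonneg T j)))))
                (λ uj≤uT → ≤-trans
                  (corner (q j) b (q L) (q T) (p B) (p R) (p j) LT′)
                  (+-mono-≤ (+-mono-≤ (D.↖ uj≤uB (B-min j)) (D.↗ (L-min j) (≤-trans σ vR≤vj)))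
                    (+-mono-≤ (D.↖ (R-max j) vR≤vj) (D.↙ uj≤uT (T-max j)))))))))

        -- If `u B ≤ u T`, the pairs LR and TB are concordant and `b` lies between the values of `q`
        -- at their ends, so these two pairs pay for the four hubs. Otherwise TB is discordant and
        -- all six pairs are used.
        four : (q L - b) ² + (q R - b) ² + ((q T - b) ² + (q B - b) ²) ≤ pairs
        four = ≤-cases (D.u B) (D.u T)
          (λ uB≤uT → ≤-trans
            (+-mono-≤ (≤-trans (²-between qL≤b b≤qR) (D.↗ (L-min R) σ))
                      (≤-trans (²-between qT≤b b≤qB) (D.↙ uB≤uT (T-max B))))
            (≤-+ (+-assoc _ _ _) ((D.nonneg L T ⊹ D.nonneg R B) ⊹ (D.nonneg L B ⊹ D.nonneg R T))))
          (λ uT≤uB → ≤-trans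
            (hub-pairs b (q L) (q R) (q T) (q B) (p L) (p R) (p T) (p B) qL≤b b≤qR LT RB)
            (+-mono-≤
              (+-mono-≤ (+-mono-≤ (D.↗ (L-min R) σ) (D.↘ uT≤uB (T-max B)))
                        (+-mono-≤ (D.↗ (L-min T) (T-max L)) (D.↙ (R-max B) (B-min R))))
              (+-mono-≤ (D.↘ (L-min B) (B-min L)) (D.↖ (R-max T) (T-max R)))))

      separated⇒Bound : Bound W q
      separated⇒Bound = suffices b at four

    -- In the last case b has to satisfy the conditions LT and RB, which are
    -- compatible by σ+τ: one says b ≤ m and is void if b is q L or q T, the
    -- other says m ≤ b and is void if b is q R or q B. So b is the point of
    -- the interval [max (q L) (q T), min (q R) (q B)] closest to m.
    bound : Bound W q
    bound = ≤-cases (q R) (q L) qR≤qL⇒Bound λ qL≤qR → ≤-cases (q B) (q T) qB≤qT⇒Bound λ qT≤qB →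
      ≤-cases (q L) (q T)
        (λ qL≤qT → lower (q T) qL≤qT ≤-refl (trans (*-congˡ (-‿inverseʳ _)) (zeroʳ _)) qT≤qR qT≤qB)
        (λ qT≤qL → lower (q L) ≤-refl qT≤qL (trans (*-congʳ (-‿inverseʳ _)) (zeroˡ _)) qL≤qR qL≤qB)
      where
      qL≤qB : q L ≤ q B
      qL≤qB = D.q-mono (L-min B) (B-min L)
      qT≤qR : q T ≤ q R
      qT≤qR = D.q-mono (R-max T) (T-max R)

      -- The linear form of `RB` is `e ≤ 2b`, and that of `LT` is `2b ≤ q L + q T + p R - p B`. The
      -- second bound exceeds `e` by the quantity in `σ+τ`.
      e : Carrier
      e = q B + q R - p T + p L

      m : Carrier
      m = proj₁ (halve e)

      m+m≈e : m + m ≈ e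
      m+m≈e = proj₂ (halve e)

      LT : ∀ {b} → b ≤ m → Paired (b - q L) (b - q T) (p R - p B)
      LT {b} b≤m = inj₂ (≤-+ (begin
        p R - p B ≈⟨ solve 9 (λ b pl ql pr qr pt qt pb qb → pr :- pb :=
            (b :- ql :+ (b :- qt)) :+ ((qb :+ qr :- pt :+ pl) :- (b :+ b) :+
            (pr :- qr :- (pl :- ql) :+ (pt :+ qt :- (pb :+ qb)))))
            refl b (p L) (q L) (p R) (q R) (p T) (q T) (p B) (q B) ⟩
        _         ≈⟨ +-congˡ (+-congʳ (+-congʳ (sym m+m≈e))) ⟩
        _         ∎)
        (x≤y⇒0≤y-x (+-mono-≤ b≤m b≤m) ⊹ σ+τ))

      RB : ∀ {b} → m ≤ b → Paired (q R - b) (q B - b) (p T - p L)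
      RB {b} m≤b = inj₂ (≤-+ (begin
        p T - p L ≈⟨ solve 5 (λ b pl qr pt qb → pt :- pl :=
            (qr :- b :+ (qb :- b)) :+ (b :+ b :- (qb :+ qr :- pt :+ pl)))
            refl b (p L) (q R) (p T) (q B) ⟩
        _         ≈⟨ +-congˡ (+-congˡ (-‿cong (sym m+m≈e))) ⟩
        _         ∎)
        (x≤y⇒0≤y-x (+-mono-≤ m≤b m≤b)))

      lower : ∀ b₁ → q L ≤ b₁ → q T ≤ b₁ → (b₁ - q L) * (b₁ - q T) ≈ 0# → b₁ ≤ q R → b₁ ≤ q B → Bound W q
      lower b₁ qL≤b₁ qT≤b₁ zero₁ b₁≤qR b₁≤qB = ≤-cases m b₁
        (λ m≤b₁ → separated⇒Bound b₁ qL≤b₁ qT≤b₁ b₁≤qR b₁≤qB (inj₁ zero₁) (RB m≤b₁))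
        (λ b₁≤m → ≤-cases (q R) (q B)
          (λ qR≤qB → upper b₁≤m (q R) b₁≤qR ≤-refl qR≤qB (trans (*-congʳ (-‿inverseʳ _)) (zeroˡ _)))
          (λ qB≤qR → upper b₁≤m (q B) b₁≤qB qB≤qR ≤-refl (trans (*-congˡ (-‿inverseʳ _)) (zeroʳ _))))
        where
        upper : b₁ ≤ m → ∀ b₂ → b₁ ≤ b₂ → b₂ ≤ q R → b₂ ≤ q B → (q R - b₂) * (q B - b₂) ≈ 0# → Bound W q
        upper b₁≤m b₂ b₁≤b₂ b₂≤qR b₂≤qB zero₂ = ≤-cases b₂ m
          (λ b₂≤m → separated⇒Bound b₂ (≤-trans qL≤b₁ b₁≤b₂) (≤-trans qT≤b₁ b₁≤b₂) b₂≤qR b₂≤qB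
            (LT b₂≤m) (inj₁ zero₂))
          (λ m≤b₂ → separated⇒Bound m (≤-trans qL≤b₁ b₁≤m) (≤-trans qT≤b₁ b₁≤m)
            (≤-trans m≤b₂ b₂≤qR) (≤-trans m≤b₂ b₂≤qB) (LT ≤-refl) (RB ≤-refl))

-- Extreme vertices and the symmetries of the square.

module Extremes {c ℓ₁ ℓ₂} (ℝ : RealNumbers c ℓ₁ ℓ₂) where
  open OrderedField ℝ
  open Sums ℝ
  open QuadraticInequalities ℝ
  open HubBounds ℝ
  open import Relation.Binary.Reasoning.Setoid setoid
  open Dominates using (u; v)

  private
    variable
      n : ℕ
      W : Fin n → Fin n → Carrier
      p q : Vector Carrier n

  -- Exchanging `p` and `q` keeps `u` and negates `v`, while negating `q` as in `dominates-neg`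
  -- exchanges `u` and `v`. Both are reflections of the plane.
  dominates-swap : Dominates W p q → Dominates W q p
  dominates-swap D = record { nonneg = D.nonneg ; symm = D.symm ; edge = λ i j → Sum.swap (D.edge i j) }
    where module D = Dominates D

  dominates-neg : Dominates W p q → Dominates W p (λ i → - q i)
  dominates-neg {q = q} D = record
    { nonneg = D.nonneg
    ; symm   = D.symm
    ; edge   = λ i j → Sum.map₂ (≤-resp-≈ (solve 2 (λ x y → (x :- y) :* (x :- y) :=
                 (:- x :- :- y) :* (:- x :- :- y)) refl (q j) (q i)) refl) (D.edge i j)
    }
    where module D = Dominates D

  -- A single hub `x` suffices with the shift `b = q x`: it pays `(q j - q x)²` for every `j`, and
  -- its own share is zero.
  star-bound : (D : Dominates W p q) (x : Fin n) → sum q ≈ 0# →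
               (∀ j → 0# ≤ (u D j - u D x) * (v D j - v D x)) → Bound W q
  star-bound {W = W} {q = q} D x ∑q≈0 x-concordant =
    ≤-trans (*-monoˡ-≤ 2# 0≤2 (∑²-shift-≤ q (q x) ∑q≈0))
      (hub-bound W (λ j → (q j - q x) ²) {x ∷ []} ([] ∷ []) D.nonneg D.symm
        (λ j → ≤-resp-≈ refl (sym (+-identityʳ _)) (D.concordant x j (x-concordant j)))
        (≤-resp-≈ (sym (trans (*-congˡ (trans (+-identityʳ _) (x≈y⇒[x-y]²≈0 refl))) (zeroʳ _))) refl
          ((D.nonneg x x ⊹ ≤-refl) ⊹ ≤-refl)))
    where module D = Dominates D

  star-bound′ : (D : Dominates W p q) (x : Fin n) → sum p ≈ 0# →
                (∀ j → 0# ≤ (u D j - u D x) * (v D x - v D j)) → Bound W p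
  star-bound′ {p = p} {q = q} D x ∑p≈0 x-discordant = star-bound (dominates-swap D) x ∑p≈0
    (λ j → ≤-resp-≈ refl (solve 4 (λ a b x y → (a :+ x :- (b :+ y)) :* (b :- y :- (a :- x))
              := (x :+ a :- (y :+ b)) :* (x :- a :- (y :- b))) refl (p j) (p x) (q j) (q x)) (x-discordant j))

  record Extremal {W : Fin n → Fin n → Carrier} {p q} (D : Dominates W p q) (L R T B : Fin n) : Set ℓ₂ where
    field
      L-min : ∀ j → u D L ≤ u D j
      R-max : ∀ j → u D j ≤ u D R
      T-max : ∀ j → v D j ≤ v D T
      B-min : ∀ j → v D B ≤ v D j
      L≢R   : L ≢ R
      L≢T   : L ≢ T
      L≢B   : L ≢ B
      R≢T   : R ≢ T
      R≢B   : R ≢ B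
      T≢B   : T ≢ B

  -- If `v R ≤ v L`, the sum condition forces `u B ≤ u T`. Negating `q` exchanges `u` and `v`, so B,
  -- T, R, L take the places of L, R, T, B, and the sum keeps its value.
  extremal-bound : (D : Dominates W p q) {L R T B : Fin n} → Extremal D L R T B → sum q ≈ 0# →
                   0# ≤ (v D R - v D L) + (u D T - u D B) → Bound W q
  extremal-bound {W = W} {p = p} {q = q} D {L} {R} {T} {B} E ∑q≈0 σ+τ = ≤-cases (v D L) (v D R)
      (λ vL≤vR → AtHubs.bound D ∑q≈0
        ((L≢R ∷ L≢T ∷ L≢B ∷ []) ∷ (R≢T ∷ R≢B ∷ []) ∷ (T≢B ∷ []) ∷ [] ∷ [])
        L-min R-max T-max B-min vL≤vR σ+τ)
      (λ vR≤vL → ≤-resp-≈ (*-congˡ (sum-cong-≋ (λ i → solve 1 (λ x → :- x :* :- x := x :* x) refl (q i)))) refl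
        (AtHubs.bound (dominates-neg D) (trans (∑-distrib-neg q) (trans (-‿cong ∑q≈0) -0#≈0#))
          ((≢-sym T≢B ∷ ≢-sym R≢B ∷ ≢-sym L≢B ∷ []) ∷ (≢-sym R≢T ∷ ≢-sym L≢T ∷ []) ∷ (≢-sym L≢R ∷ []) ∷ [] ∷ [])
          B-min T-max (λ j → turn (R-max j)) (λ j → turn (L-min j))
          (turn (0≤y-x⇒x≤y (≤-resp-≈ refl (solve 2 (λ s t → s :+ t :+ :- s := t) refl _ _)
            (σ+τ ⊹ ≤-resp-≈ -0#≈0# refl (neg-mono-≤ (x-y≤0 vR≤vL))))))
          (≤-resp-≈ refl (trans (+-comm _ _) (+-congʳ (+-cong (turn≈ T) (-‿cong (turn≈ B))))) σ+τ)))
    where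
    open Extremal E
    turn≈ : ∀ i → u D i ≈ v (dominates-neg D) i
    turn≈ i = solve 2 (λ p q → p :+ q := p :- :- q) refl (p i) (q i)
    turn : ∀ {i j} → u D i ≤ u D j → v (dominates-neg D) i ≤ v (dominates-neg D) j
    turn = ≤-resp-≈ (turn≈ _) (turn≈ _)
    x-y≤0 : ∀ {x y} → x ≤ y → x - y ≤ 0#
    x-y≤0 {x} {y} x≤y = ≤-resp-≈ refl (-‿inverseʳ y) (+-monoˡ-≤ (- y) x≤y)

  argmin : ∀ {ℓ} {C : Set ℓ} {n} (f : Vector Carrier (suc n)) →
           (∀ i → (∀ j → f i ≤ f j) → ¬ C) → ¬ C
  argmin {n = zero}  f k = k zero (λ { zero → ≤-refl })
  argmin {n = suc n} f k = argmin (f ∘ suc) λ i fi-min → ≤-cases (f zero) (f (suc i))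
    (λ f0≤fi → k zero (λ { zero → ≤-refl ; (suc j) → ≤-trans f0≤fi (fi-min j) }))
    (λ fi≤f0 → k (suc i) (λ { zero → fi≤f0 ; (suc j) → fi-min j }))

  argmax : ∀ {ℓ} {C : Set ℓ} {n} (f : Vector Carrier (suc n)) →
           (∀ i → (∀ j → f j ≤ f i) → ¬ C) → ¬ C
  argmax f k = argmin (λ i → - f i) λ i fi-max → k i λ j →
    ≤-resp-≈ (-‿involutive _) (-‿involutive _) (neg-mono-≤ (fi-max j))

  -- Two coinciding extremes yield a vertex that is concordant with all vertices or discordant with
  -- all; if L and R coincide, T is one, because `u` is constant. With four distinct extremes the
  -- sign of `(V R - V L) + (U T - U B)` selects `q` or `p`.
  bound-either : ∀ {ℓ} {C : Set ℓ} {n} {W : Fin (suc n) → Fin (suc n) → Carrier} {p q} →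
                 Dominates W p q → sum p ≈ 0# → sum q ≈ 0# →
                 (Bound W p → ¬ C) → (Bound W q → ¬ C) → ¬ C
  bound-either {C = C} {n = n} {W = W} {p} {q} D ∑p≈0 ∑q≈0 kp kq =
    argmin U λ L L-min → argmax U λ R R-max → argmax V λ T T-max → argmin V λ B B-min →
      dispatch L-min R-max T-max B-min
    where
    U V : Vector Carrier (suc n)
    U = u D
    V = v D
    concordant : ∀ {x} → (∀ j → 0# ≤ (U j - U x) * (V j - V x)) → ¬ C
    concordant h = kq (star-bound D _ ∑q≈0 h)
    discordant : ∀ {x} → (∀ j → 0# ≤ (U j - U x) * (V x - V j)) → ¬ C
    discordant h = kp (star-bound′ D _ ∑p≈0 h)
    neg*neg : ∀ {a b x y} → a ≤ x → b ≤ y → 0# ≤ (a - x) * (b - y)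
    neg*neg {a} {b} {x} {y} a≤x b≤y = ≤-resp-≈ refl
      (solve 4 (λ a b x y → (x :- a) :* (y :- b) := (a :- x) :* (b :- y)) refl a b x y)
      (x≤y⇒0≤y-x a≤x ⊛ x≤y⇒0≤y-x b≤y)
    dispatch : ∀ {L R T B} → (∀ j → U L ≤ U j) → (∀ j → U j ≤ U R) →
               (∀ j → V j ≤ V T) → (∀ j → V B ≤ V j) → ¬ C
    dispatch {L} {R} {T} {B} L-min R-max T-max B-min
      with L Fin.≟ R | L Fin.≟ T | L Fin.≟ B | R Fin.≟ T | R Fin.≟ B | T Fin.≟ B
    ... | yes ≡.refl | _ | _ | _ | _ | _ =
      concordant {T} λ j → neg*neg (≤-trans (R-max j) (L-min T)) (T-max j)
    ... | _ | yes ≡.refl | _ | _ | _ | _ =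
      discordant {L} λ j → x≤y⇒0≤y-x (L-min j) ⊛ x≤y⇒0≤y-x (T-max j)
    ... | _ | _ | yes ≡.refl | _ | _ | _ =
      concordant {L} λ j → x≤y⇒0≤y-x (L-min j) ⊛ x≤y⇒0≤y-x (B-min j)
    ... | _ | _ | _ | yes ≡.refl | _ | _ =
      concordant {R} λ j → neg*neg (R-max j) (T-max j)
    ... | _ | _ | _ | _ | yes ≡.refl | _ =
      discordant {R} λ j → neg*neg (R-max j) (B-min j)
    ... | _ | _ | _ | _ | _ | yes ≡.refl =
      concordant {L} λ j → x≤y⇒0≤y-x (L-min j) ⊛ x≤y⇒0≤y-x (≤-trans (T-max L) (B-min j))
    ... | no L≢R | no L≢T | no L≢B | no R≢T | no R≢B | no T≢B =
      ≤-cases 0# ((V R - V L) + (U T - U B))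
        (λ 0≤σ+τ → kq (extremal-bound D (record
          { L-min = L-min ; R-max = R-max ; T-max = T-max ; B-min = B-min
          ; L≢R = L≢R ; L≢T = L≢T ; L≢B = L≢B ; R≢T = R≢T ; R≢B = R≢B ; T≢B = T≢B }) ∑q≈0 0≤σ+τ))
        -- Exchanging `p` and `q` negates `v`, so T and B change places and the sum changes sign.
        (λ σ+τ≤0 → kp (extremal-bound (dominates-swap D) {L} {R} {B} {T} (record
          { L-min = λ j → same (L-min j)
          ; R-max = λ j → same (R-max j)
          ; T-max = λ j → flipped (B-min j)
          ; B-min = λ j → flipped (T-max j)
          ; L≢R = L≢R ; L≢T = L≢B ; L≢B = L≢T ; R≢T = R≢B ; R≢B = R≢T ; T≢B = ≢-sym T≢B }) ∑p≈0
          (≤-resp-≈ -0#≈0#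
            (solve 8 (λ pl ql pr qr pt qt pb qb →
              :- (pr :- qr :- (pl :- ql) :+ (pt :+ qt :- (pb :+ qb))) :=
              qr :- pr :- (ql :- pl) :+ (qb :+ pb :- (qt :+ pt)))
              refl (p L) (q L) (p R) (q R) (p T) (q T) (p B) (q B))
            (neg-mono-≤ σ+τ≤0))))
      where
      same : ∀ {i j} → U i ≤ U j → u (dominates-swap D) i ≤ u (dominates-swap D) j
      same = ≤-resp-≈ (+-comm _ _) (+-comm _ _)
      flipped : ∀ {i j} → V i ≤ V j → v (dominates-swap D) j ≤ v (dominates-swap D) i
      flipped {i} {j} Vi≤Vj = ≤-resp-≈ (lem j) (lem i) (neg-mono-≤ Vi≤Vj)
        where
        lem : ∀ i → - (p i - q i) ≈ q i - p i
        lem i = solve 2 (λ p q → :- (p :- q) := q :- p) refl (p i) (q i)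

-- Determinants, cofactors and null vectors.

module Determinant {c ℓ₁ ℓ₂} (ℝ : RealNumbers c ℓ₁ ℓ₂) where
  open OrderedField ℝ
  open Sums ℝ
  open Laplacian ℝ using (Matrix; det)
  open import Relation.Binary.Reasoning.Setoid setoid

  private
    variable
      n : ℕ

  -1^_ : ℕ → Carrier
  -1^ k = (- 1#) ^ k

  det-cong : {M N : Matrix n} → (∀ i j → M i j ≈ N i j) → det M ≈ det N
  det-cong {zero}  M≈N = refl
  det-cong {suc n} M≈N = sum-cong-≋ {suc n} λ j → *-congˡ {x = -1^ toℕ j}
    (*-cong (M≈N zero j) (det-cong λ i k → M≈N (suc i) (punchIn j k)))

  minor : ∀ {m} → Vector (Vector Carrier (suc n)) m → Fin (suc n) → Vector (Vector Carrier n) m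
  minor T j i = removeAt (T i) j

  -- The argument omits the first row, so the same cofactors serve every choice of that row, in
  -- particular a repeated row or the row of ones.
  cofactor : Vector (Vector Carrier (suc n)) n → Vector Carrier (suc n)
  cofactor T j = -1^ toℕ j * det (minor T j)

  infix 8 _∙_
  _∙_ : Vector Carrier n → Vector Carrier n → Carrier
  v ∙ w = sum λ j → v j * w j

  det≈row∙cofactor : (M : Matrix (suc n)) → det M ≈ M zero ∙ cofactor (tail M)
  det≈row∙cofactor {n} M = sum-cong-≋ {suc n} λ j →
    solve 3 (λ s m d → s :* (m :* d) := m :* (s :* d)) refl (-1^ toℕ j) (M zero j) (det (minor (tail M) j))

  private
    Respects-≗ : ∀ {m k} → ((Fin m → Fin k) → Carrier) → Set _
    Respects-≗ φ = ∀ {g h} → g ≗ h → φ g ≈ φ h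

    lift : ∀ {m k} → (Fin m → Fin k) → Fin (suc m) → Fin (suc k)
    lift h zero    = zero
    lift h (suc i) = suc (h i)

    -- Deleting columns j and then k of the rest is the same as deleting them
    -- in the opposite order, but the signs of the two terms differ.
    cancel-pairs : ∀ n s (a b : Vector Carrier (suc (suc n))) (φ : (Fin n → Fin (suc (suc n))) → Carrier) →
      Respects-≗ φ →
      sum (λ j → sum λ k → s * (-1^ toℕ j * -1^ toℕ k) *
        ((a j * b (punchIn j k) + b j * a (punchIn j k)) * φ (punchIn j ∘ punchIn k))) ≈ 0#
    cancel-pairs n s a b φ φ-resp = begin
      sum (λ k → F zero k) + sum (λ j → F (suc j) zero + sum λ k → F (suc j) (suc k))
        ≈⟨ +-congˡ (∑-distrib-+ (λ j → F (suc j) zero) (λ j → sum λ k → F (suc j) (suc k))) ⟩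
      sum (λ k → F zero k) + (sum (λ j → F (suc j) zero) + sum (λ j → sum λ k → F (suc j) (suc k)))
        ≈⟨ +-assoc _ _ _ ⟨
      sum (λ k → F zero k) + sum (λ j → F (suc j) zero) + sum (λ j → sum λ k → F (suc j) (suc k))
        ≈⟨ +-cong (trans (sym (∑-distrib-+ (F zero) (λ j → F (suc j) zero))) (sum-zero first)) (rest n a b φ φ-resp) ⟩
      0# + 0#
        ≈⟨ +-identityˡ 0# ⟩
      0# ∎
      where
      F : Fin (suc (suc n)) → Fin (suc n) → Carrier
      F j k = s * (-1^ toℕ j * -1^ toℕ k) *
        ((a j * b (punchIn j k) + b j * a (punchIn j k)) * φ (punchIn j ∘ punchIn k))
      -- `F zero k` and `F (suc k) zero` concern the same columns, 0 and `k + 1`. The pairs that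
      -- avoid column 0 are left to the recursion in `rest`.
      first : ∀ k → F zero k + F (suc k) zero ≈ 0#
      first k = solve 7 (λ s t a₀ b₀ a b e →
        s :* (con (+ 1) :* t) :* ((a₀ :* b :+ b₀ :* a) :* e) :+
        s :* (:- con (+ 1) :* t :* con (+ 1)) :* ((a :* b₀ :+ b :* a₀) :* e) := con (+ 0))
        refl s (-1^ toℕ k) (a zero) (b zero) (a (suc k)) (b (suc k)) (φ (suc ∘ punchIn k))
      rest : ∀ n (a b : Vector Carrier (suc (suc n))) (φ : (Fin n → Fin (suc (suc n))) → Carrier) → Respects-≗ φ →
        sum {suc n} (λ j → sum {n} λ k → s * (-1^ suc (toℕ j) * -1^ suc (toℕ k)) *
          ((a (suc j) * b (suc (punchIn j k)) + b (suc j) * a (suc (punchIn j k))) *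
            φ (punchIn (suc j) ∘ punchIn (suc k)))) ≈ 0#
      rest zero    a b φ φ-resp = +-identityˡ 0#
      rest (suc n) a b φ φ-resp = trans
        (sum-cong-≋ {suc (suc n)} λ j → sum-cong-≋ {suc n} λ k → *-cong
          (solve 3 (λ s t u → s :* ((:- con (+ 1) :* t) :* (:- con (+ 1) :* u)) := s :* (t :* u)) refl
            s (-1^ toℕ j) (-1^ toℕ k))
          (*-congˡ {x = a (suc j) * b (suc (punchIn j k)) + b (suc j) * a (suc (punchIn j k))}
            (φ-resp {g = punchIn (suc j) ∘ punchIn (suc k)} {h = lift (punchIn j ∘ punchIn k)} λ { zero → ≡.refl ; (suc i) → ≡.refl })))
        (cancel-pairs n s (tail a) (tail b) (φ ∘ lift)
          (λ g≗h → φ-resp λ { zero → ≡.refl ; (suc i) → ≡.cong suc (g≗h i) }))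

  det-swap : (a b : Vector Carrier (suc (suc n))) (T : Vector (Vector Carrier (suc (suc n))) n) →
             det (a ∷ᵛ b ∷ᵛ T) + det (b ∷ᵛ a ∷ᵛ T) ≈ 0#
  det-swap {n} a b T = begin
    det (a ∷ᵛ b ∷ᵛ T) + det (b ∷ᵛ a ∷ᵛ T)
      ≈⟨ ∑-distrib-+ (λ j → -1^ toℕ j * (a j * sum (G b j))) (λ j → -1^ toℕ j * (b j * sum (G a j))) ⟨
    sum (λ j → -1^ toℕ j * (a j * sum (G b j)) + -1^ toℕ j * (b j * sum (G a j)))
      ≈⟨ sum-cong-≋ {suc (suc n)} (λ j → combine j) ⟩
    sum (λ j → sum λ k → 1# * (-1^ toℕ j * -1^ toℕ k) *
        ((a j * b (punchIn j k) + b j * a (punchIn j k)) * φ (punchIn j ∘ punchIn k)))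
      ≈⟨ cancel-pairs n 1# a b φ (λ g≗h → det-cong (λ i k → reflexive (≡.cong (T i) (g≗h k)))) ⟩
    0# ∎
    where
    φ : (Fin n → Fin (suc (suc n))) → Carrier
    φ h = det (λ i → T i ∘ h)
    G : Vector Carrier (suc (suc n)) → Fin (suc (suc n)) → Vector Carrier (suc n)
    G b j k = -1^ toℕ k * (b (punchIn j k) * φ (punchIn j ∘ punchIn k))
    combine : ∀ j → -1^ toℕ j * (a j * sum (G b j)) + -1^ toℕ j * (b j * sum (G a j)) ≈
      sum (λ k → 1# * (-1^ toℕ j * -1^ toℕ k) *
        ((a j * b (punchIn j k) + b j * a (punchIn j k)) * φ (punchIn j ∘ punchIn k)))
    combine j = begin
      -1^ toℕ j * (a j * sum (G b j)) + -1^ toℕ j * (b j * sum (G a j))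
        ≈⟨ +-cong (*-assoc _ _ _) (*-assoc _ _ _) ⟨
      -1^ toℕ j * a j * sum (G b j) + -1^ toℕ j * b j * sum (G a j)
        ≈⟨ +-cong (*-distribˡ-sum _ (G b j)) (*-distribˡ-sum _ (G a j)) ⟩
      sum (λ k → -1^ toℕ j * a j * G b j k) + sum (λ k → -1^ toℕ j * b j * G a j k)
        ≈⟨ ∑-distrib-+ (λ k → -1^ toℕ j * a j * G b j k) (λ k → -1^ toℕ j * b j * G a j k) ⟨
      sum (λ k → -1^ toℕ j * a j * G b j k + -1^ toℕ j * b j * G a j k)
        ≈⟨ sum-cong-≋ {suc n} (λ k → solve 7 (λ s t aj bj ak bk e →
             s :* aj :* (t :* (bk :* e)) :+ s :* bj :* (t :* (ak :* e)) :=
             con (+ 1) :* (s :* t) :* ((aj :* bk :+ bj :* ak) :* e)) refl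
             (-1^ toℕ j) (-1^ toℕ k) (a j) (b j) (a (punchIn j k)) (b (punchIn j k)) (φ (punchIn j ∘ punchIn k))) ⟩
      _ ∎

  x+x≈0⇒x≈0 : ∀ {x} → x + x ≈ 0# → x ≈ 0#
  x+x≈0⇒x≈0 {x} x+x≈0 = *-cancelˡ-0 (>⇒# 0<2) (trans (double x) x+x≈0)

  -- If the copy stands next to its original, exchanging the two negates the determinant without
  -- changing it. Otherwise exchange the copy with the second row and expand along the new first
  -- row: the minors have a repeated row and vanish by induction.
  det-repeated-row : (T : Vector (Vector Carrier (suc n)) n) (i : Fin n) → det (T i ∷ᵛ T) ≈ 0#
  det-repeated-row T zero = x+x≈0⇒x≈0 (trans (+-cong T≈ T≈) (det-swap (T zero) (T zero) (tail T)))
    where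
    T≈ : det (T zero ∷ᵛ T) ≈ det (T zero ∷ᵛ T zero ∷ᵛ tail T)
    T≈ = det-cong {M = T zero ∷ᵛ T} {N = T zero ∷ᵛ T zero ∷ᵛ tail T} λ { zero j → refl ; (suc zero) j → refl ; (suc (suc i)) j → refl }
  det-repeated-row {suc n} T (suc i) = begin
    det (T (suc i) ∷ᵛ T)                     ≈⟨ det-cong {M = T (suc i) ∷ᵛ T} {N = T (suc i) ∷ᵛ T zero ∷ᵛ tail T}
                                                  (λ { zero j → refl ; (suc zero) j → refl ; (suc (suc i)) j → refl }) ⟩
    det (T (suc i) ∷ᵛ T zero ∷ᵛ tail T)       ≈⟨ x-0≈x _ ⟨
    det (T (suc i) ∷ᵛ T zero ∷ᵛ tail T) - 0#  ≈⟨ +-congˡ (-‿cong swapped≈0) ⟨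
    det (T (suc i) ∷ᵛ T zero ∷ᵛ tail T) - det (T zero ∷ᵛ T (suc i) ∷ᵛ tail T)
      ≈⟨ solve 2 (λ x y → x :- y := x :+ y :- (y :+ y)) refl _ _ ⟩
    det (T (suc i) ∷ᵛ T zero ∷ᵛ tail T) + det (T zero ∷ᵛ T (suc i) ∷ᵛ tail T)
      - (det (T zero ∷ᵛ T (suc i) ∷ᵛ tail T) + det (T zero ∷ᵛ T (suc i) ∷ᵛ tail T))
      ≈⟨ +-cong (det-swap (T (suc i)) (T zero) (tail T)) (-‿cong (trans (+-cong swapped≈0 swapped≈0) (+-identityˡ 0#))) ⟩
    0# - 0#                                 ≈⟨ -‿inverseʳ 0# ⟩
    0#                                      ∎
    where
    swapped≈0 : det (T zero ∷ᵛ T (suc i) ∷ᵛ tail T) ≈ 0#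
    swapped≈0 = sum-zero {suc (suc n)} λ j →
      trans (*-congˡ {x = -1^ toℕ j} (trans (*-congˡ {x = T zero j} (trans
        (det-cong {M = minor (T (suc i) ∷ᵛ tail T) j} {N = minor (tail T) j i ∷ᵛ minor (tail T) j} λ { zero k → refl ; (suc i) k → refl })
        (det-repeated-row (minor (tail T) j) i))) (zeroʳ _))) (zeroʳ _)

  row∙cofactor : (T : Vector (Vector Carrier (suc n)) n) (i : Fin n) → T i ∙ cofactor T ≈ 0#
  row∙cofactor T i = trans (sym (det≈row∙cofactor (T i ∷ᵛ T))) (det-repeated-row T i)

  #-or-zero : ∀ {ℓ} {C : Set ℓ} (f : Vector Carrier n) →
              (∀ j → f j # 0# → ¬ C) → ((∀ j → f j ≈ 0#) → ¬ C) → ¬ C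
  #-or-zero {zero}  f ap eq = eq λ ()
  #-or-zero {suc n} f ap eq = #-≈-cases (f zero) 0# (ap zero) λ f0≈0 →
    #-or-zero (f ∘ suc) (ap ∘ suc) λ fs≈0 → eq λ { zero → f0≈0 ; (suc j) → fs≈0 j }

  -1^k*-1^k≈1 : ∀ k → -1^ k * -1^ k ≈ 1#
  -1^k*-1^k≈1 zero    = *-identityˡ 1#
  -1^k*-1^k≈1 (suc k) = trans
    (solve 1 (λ s → (:- con (+ 1) :* s) :* (:- con (+ 1) :* s) := s :* s) refl (-1^ k)) (-1^k*-1^k≈1 k)

  ∙-insertAt : (t : Vector Carrier (suc n)) (w : Vector Carrier n) (j : Fin (suc n)) →
               t ∙ insertAt w j 0# ≈ removeAt t j ∙ w
  ∙-insertAt {n} t w j = begin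
    t ∙ insertAt w j 0#
      ≈⟨ sum-remove {i = j} (λ k → t k * insertAt w j 0# k) ⟩
    t j * insertAt w j 0# j + sum (λ k → t (punchIn j k) * insertAt w j 0# (punchIn j k))
      ≈⟨ +-cong (trans (*-congˡ (reflexive (Vector.insertAt-lookup w j 0#))) (zeroʳ _))
           (sum-cong-≋ {n} (λ k → *-congˡ (reflexive (Vector.insertAt-punchIn w j 0# k)))) ⟩
    0# + removeAt t j ∙ w
      ≈⟨ +-identityˡ _ ⟩
    removeAt t j ∙ w ∎

  ∙-linear : (t v w : Vector Carrier n) (a b : Carrier) →
             t ∙ (λ j → a * v j - b * w j) ≈ a * (t ∙ v) - b * (t ∙ w)
  ∙-linear {n} t v w a b = begin
    t ∙ (λ j → a * v j - b * w j)
      ≈⟨ sum-cong-≋ {n} (λ j → solve 5 (λ t v w a b → t :* (a :* v :- b :* w) := a :* (t :* v) :- b :* (t :* w))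
           refl (t j) (v j) (w j) a b) ⟩
    sum (λ j → a * (t j * v j) - b * (t j * w j))
      ≈⟨ ∑-distrib-- (λ j → a * (t j * v j)) (λ j → b * (t j * w j)) ⟩
    sum (λ j → a * (t j * v j)) - sum (λ j → b * (t j * w j))
      ≈⟨ +-cong (*-distribˡ-sum a (λ j → t j * v j)) (-‿cong (*-distribˡ-sum b (λ j → t j * w j))) ⟨
    a * (t ∙ v) - b * (t ∙ w) ∎

  -- If the cofactors of the first row do not all vanish, they form a null
  -- vector. Otherwise null vectors of two minors give two independent null
  -- vectors of the remaining rows, and some combination of them is
  -- orthogonal to the first row.
  null-vector : ∀ {ℓ} {C : Set ℓ} (M : Matrix n) → det M ≈ 0# →
                (∀ v k → v k # 0# → (∀ i → M i ∙ v ≈ 0#) → ¬ C) → ¬ C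
  null-vector {zero}  M 1≈0   _ _ = #-irrefl 1≈0 1#0
  null-vector {suc n} M det≈0 found = #-or-zero (cofactor T)
    (λ j cj#0 → found (cofactor T) j cj#0 λ where
      zero    → trans (sym (det≈row∙cofactor M)) det≈0
      (suc i) → row∙cofactor T i)
    (λ cofactor≈0 →
      null-vector (minor T zero) (minor-singular cofactor≈0 zero) λ w k wk#0 w-null →
      -- The first null vector, with a zero inserted in column 0, is nonzero in column `suc k`; the
      -- second one gets a zero there, so the two are independent.
      null-vector (minor T (suc k)) (minor-singular cofactor≈0 (suc k)) λ w′ k′ w′k′#0 w′-null →
      two-null-vectors w k wk#0 w-null w′ k′ w′k′#0 w′-null)
    where
    T = tail M
    minor-singular : (∀ j → cofactor T j ≈ 0#) → ∀ j → det (minor T j) ≈ 0#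
    minor-singular cofactor≈0 j = begin
      det (minor T j)                                 ≈⟨ *-identityˡ _ ⟨
      1# * det (minor T j)                            ≈⟨ *-congʳ (-1^k*-1^k≈1 (toℕ j)) ⟨
      (-1^ toℕ j * -1^ toℕ j) * det (minor T j)       ≈⟨ *-assoc _ _ _ ⟩
      -1^ toℕ j * cofactor T j                        ≈⟨ *-congˡ (cofactor≈0 j) ⟩
      -1^ toℕ j * 0#                                  ≈⟨ zeroʳ _ ⟩
      0#                                              ∎
    two-null-vectors : ∀ w k → w k # 0# → (∀ i → minor T zero i ∙ w ≈ 0#) →
                       ∀ w′ k′ → w′ k′ # 0# → (∀ i → minor T (suc k) i ∙ w′ ≈ 0#) → ¬ _
    two-null-vectors w k wk#0 w-null w′ k′ w′k′#0 w′-null = #-≈-cases t 0#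
      -- The factors `t` and `s` make the combination orthogonal to the first row. Its entry in
      -- column `suc k` is `t * w k`, which is apart from 0; if `t` is zero, `v′` itself will do.
      (λ t#0 → found (λ j → t * v j - s * v′ j) (suc k)
        (#-congʳ (sym (begin
            t * w k - s * v′ (suc k)  ≈⟨ +-congˡ (-‿cong (*-congˡ (reflexive (Vector.insertAt-lookup w′ (suc k) 0#)))) ⟩
            t * w k - s * 0#          ≈⟨ +-congˡ (-‿cong (zeroʳ s)) ⟩
            t * w k - 0#              ≈⟨ x-0≈x _ ⟩
            t * w k                   ∎))
          (x#0y#0→xy#0 t#0 wk#0))
        λ where
          zero    → trans (∙-linear (M zero) v v′ t s) (solve 2 (λ s t → t :* s :- s :* t := con (+ 0)) refl s t)
          (suc i) → trans (∙-linear (T i) v v′ t s)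
            (trans (+-cong (trans (*-congˡ (Tv≈0 i)) (zeroʳ t)) (-‿cong (trans (*-congˡ (Tv′≈0 i)) (zeroʳ s)))) (-‿inverseʳ 0#)))
      (λ t≈0 → found v′ (punchIn (suc k) k′)
        (#-congʳ (sym (reflexive (Vector.insertAt-punchIn w′ (suc k) 0# k′))) w′k′#0)
        λ where
          zero    → t≈0
          (suc i) → Tv′≈0 i)
      where
      v v′ : Vector Carrier (suc n)
      v  = insertAt w zero 0#
      v′ = insertAt w′ (suc k) 0#
      s = M zero ∙ v
      t = M zero ∙ v′
      Tv≈0 : ∀ i → T i ∙ v ≈ 0#
      Tv≈0 i = trans (∙-insertAt (T i) w zero) (w-null i)
      Tv′≈0 : ∀ i → T i ∙ v′ ≈ 0#
      Tv′≈0 i = trans (∙-insertAt (T i) w′ (suc k)) (w′-null i)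

  -- Write the first row as the constant `x` minus the sum of the other rows; those rows are
  -- orthogonal to the cofactors.
  det-constant-column-sums : (M : Matrix (suc n)) (x : Carrier) →
    (∀ j → sum (λ i → M i j) ≈ x) → det M ≈ x * sum (cofactor (tail M))
  det-constant-column-sums {n} M x ∑M≈x = begin
    det M                                                        ≈⟨ det≈row∙cofactor M ⟩
    sum (λ j → M zero j * C j)                                   ≈⟨ sum-cong-≋ {suc n} (λ j → row₀ j) ⟩
    sum (λ j → x * C j - sum (λ i → M (suc i) j * C j))          ≈⟨ ∑-distrib-- (λ j → x * C j) (λ j → sum λ i → M (suc i) j * C j) ⟩
    sum (λ j → x * C j) - sum (λ j → sum λ i → M (suc i) j * C j)
      ≈⟨ +-cong (sym (*-distribˡ-sum x C)) (-‿cong (∑-comm (λ j i → M (suc i) j * C j))) ⟩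
    x * sum C - sum (λ i → M (suc i) ∙ C)                        ≈⟨ +-congˡ (-‿cong (sum-zero {n} (row∙cofactor (tail M)))) ⟩
    x * sum C - 0#                                               ≈⟨ x-0≈x _ ⟩
    x * sum C                                                    ∎
    where
    C = cofactor (tail M)
    row₀ : ∀ j → M zero j * C j ≈ x * C j - sum (λ i → M (suc i) j * C j)
    row₀ j = begin
      M zero j * C j
        ≈⟨ solve 3 (λ m s c → m :* c := (m :+ s) :* c :- s :* c) refl (M zero j) (sum (λ i → M (suc i) j)) (C j) ⟩
      sum (λ i → M i j) * C j - sum (λ i → M (suc i) j) * C j
        ≈⟨ +-cong (*-congʳ (∑M≈x j)) (-‿cong (*-distribʳ-sum (C j) (λ i → M (suc i) j))) ⟩
      x * C j - sum (λ i → M (suc i) j * C j) ∎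

-- Polynomial functions near zero.

module Polynomial {c ℓ₁ ℓ₂} (ℝ : RealNumbers c ℓ₁ ℓ₂) where
  open OrderedField ℝ
  open Sums ℝ
  open Laplacian ℝ using (Matrix; det)
  open Determinant ℝ using (-1^_)
  open import Relation.Binary.Reasoning.Setoid setoid

  -- Expressions indexed by the functions they denote. Division by `x` and bounds then follow by
  -- induction on the expression, with no list of coefficients.
  data Poly : (Carrier → Carrier) → Set c where
    constᵖ : ∀ a → Poly (λ _ → a)
    idᵖ    : Poly (λ x → x)
    _+ᵖ_   : ∀ {f g} → Poly f → Poly g → Poly (λ x → f x + g x)
    _*ᵖ_   : ∀ {f g} → Poly f → Poly g → Poly (λ x → f x * g x)

  -ᵖ_ : ∀ {f} → Poly f → Poly (λ x → - 1# * f x)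
  -ᵖ F = constᵖ (- 1#) *ᵖ F

  sumᵖ : ∀ {n} {f : Fin n → Carrier → Carrier} → (∀ i → Poly (f i)) → Poly (λ x → sum (λ i → f i x))
  sumᵖ {zero}  F = constᵖ 0#
  sumᵖ {suc n} F = F zero +ᵖ sumᵖ (F ∘ suc)

  productᵖ : ∀ {n} {f : Fin n → Carrier → Carrier} → (∀ i → Poly (f i)) → Poly (λ x → product (λ i → f i x))
  productᵖ {zero}  F = constᵖ 1#
  productᵖ {suc n} F = F zero *ᵖ productᵖ (F ∘ suc)

  detᵖ : ∀ {n} {M : Fin n → Fin n → Carrier → Carrier} → (∀ i j → Poly (M i j)) → Poly (λ x → det (λ i j → M i j x))
  detᵖ {zero}  F = constᵖ 1#
  detᵖ {suc n} F = sumᵖ λ j → constᵖ (-1^ toℕ j) *ᵖ (F zero j *ᵖ detᵖ (λ i k → F (suc i) (punchIn j k)))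

  quotient : ∀ {f} → Poly f → ∃[ h ] Poly h × (∀ x → f x ≈ f 0# + x * h x)
  quotient (constᵖ a) = _ , constᵖ 0# , λ x → solve 2 (λ a x → a := a :+ x :* con (+ 0)) refl a x
  quotient idᵖ        = _ , constᵖ 1# , λ x → solve 1 (λ x → x := con (+ 0) :+ x :* con (+ 1)) refl x
  quotient (_+ᵖ_ {f} {g} F G) with quotient F | quotient G
  ... | h , H , f≈ | k , K , g≈ = _ , H +ᵖ K , λ x → trans (+-cong (f≈ x) (g≈ x))
    (solve 5 (λ f g h k x → f :+ x :* h :+ (g :+ x :* k) := f :+ g :+ x :* (h :+ k)) refl (f 0#) (g 0#) (h x) (k x) x)
  quotient (_*ᵖ_ {f} {g} F G) with quotient F | quotient G
  ... | h , H , f≈ | k , K , g≈ = _ , (H *ᵖ G) +ᵖ (constᵖ (f 0#) *ᵖ K) , λ x → begin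
    f x * g x                                   ≈⟨ *-congʳ (f≈ x) ⟩
    (f 0# + x * h x) * g x                      ≈⟨ solve 4 (λ f g h x → (f :+ x :* h) :* g := f :* g :+ x :* (h :* g)) refl (f 0#) (g x) (h x) x ⟩
    f 0# * g x + x * (h x * g x)                ≈⟨ +-congʳ (*-congˡ (g≈ x)) ⟩
    f 0# * (g 0# + x * k x) + x * (h x * g x)
      ≈⟨ solve 5 (λ f g k x e → f :* (g :+ x :* k) :+ x :* e := f :* g :+ x :* (e :+ f :* k)) refl (f 0#) (g 0#) (k x) x (h x * g x) ⟩
    f 0# * g 0# + x * (h x * g x + f 0# * k x)  ∎

  -- The two one-sided bounds express `|f x| ≤ K` on the unit interval. For a constant `a` the
  -- choice `1 + a²` avoids deciding its sign, and for products `2(KL - fg) = (K - f)(L + g) + (K +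
  -- f)(L - g)`.
  bounded : ∀ {f} → Poly f → ∃[ K ] ((∀ x → 0# ≤ x → x ≤ 1# → 0# ≤ K - f x × 0# ≤ K + f x))
  bounded (constᵖ a) = 1# + a ² , λ x _ _ →
      0≤-half (solve 1 (λ a → (con (+ 1) :+ con (+ 1)) :* (con (+ 1) :+ a :* a :- a) :=
              con (+ 1) :+ a :* a :+ (a :- con (+ 1)) :* (a :- con (+ 1))) refl a) (0≤1 ⊹ 0≤x² a ⊹ 0≤x² (a - 1#))
    , 0≤-half (solve 1 (λ a → (con (+ 1) :+ con (+ 1)) :* (con (+ 1) :+ a :* a :+ a) :=
              con (+ 1) :+ a :* a :+ (a :+ con (+ 1)) :* (a :+ con (+ 1))) refl a) (0≤1 ⊹ 0≤x² a ⊹ 0≤x² (a + 1#))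
  bounded idᵖ = 1# , λ x 0≤x x≤1 → x≤y⇒0≤y-x x≤1 , 0≤1 ⊹ 0≤x
  bounded (_+ᵖ_ {f} {g} F G) with bounded F | bounded G
  ... | K , f≤ | L , g≤ = K + L , λ x 0≤x x≤1 →
      ≤-resp-≈ refl (solve 4 (λ k l f g → k :- f :+ (l :- g) := k :+ l :- (f :+ g)) refl K L (f x) (g x))
        (proj₁ (f≤ x 0≤x x≤1) ⊹ proj₁ (g≤ x 0≤x x≤1))
    , ≤-resp-≈ refl (solve 4 (λ k l f g → k :+ f :+ (l :+ g) := k :+ l :+ (f :+ g)) refl K L (f x) (g x))
        (proj₂ (f≤ x 0≤x x≤1) ⊹ proj₂ (g≤ x 0≤x x≤1))
  bounded (_*ᵖ_ {f} {g} F G) with bounded F | bounded G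
  ... | K , f≤ | L , g≤ = K * L , λ x 0≤x x≤1 → let (a , a′) = f≤ x 0≤x x≤1 ; (b , b′) = g≤ x 0≤x x≤1 in
      0≤-half (solve 4 (λ k l f g → (con (+ 1) :+ con (+ 1)) :* (k :* l :- f :* g) :=
              (k :- f) :* (l :+ g) :+ (k :+ f) :* (l :- g)) refl K L (f x) (g x)) (a ⊛ b′ ⊹ a′ ⊛ b)
    , 0≤-half (solve 4 (λ k l f g → (con (+ 1) :+ con (+ 1)) :* (k :* l :+ f :* g) :=
              (k :- f) :* (l :- g) :+ (k :+ f) :* (l :+ g)) refl K L (f x) (g x)) (a ⊛ b ⊹ a′ ⊛ b′)

  private
    module _ {f h : Carrier → Carrier} {K : Carrier} (f≈ : ∀ x → f x ≈ f 0# + x * h x)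
      (bound : ∀ x → 0# ≤ x → x ≤ 1# → 0# ≤ K - h x × 0# ≤ K + h x)
      (f≈0 : ∀ x → 0# < x → f x ≈ 0#) (0<f0 : 0# < f 0#)
      where

      e e⁻¹ : Carrier
      e   = f 0#
      e⁻¹ = e ⁻¹⟨ >⇒# 0<f0 ⟩

      module _ (N δ : Carrier) (0<N : 0# < N) (0<δ : 0# < δ) (δ≤1 : δ ≤ 1#)
        (Nδ≈1 : N * δ ≈ 1#) (Ke⁻¹δ<1 : K * e⁻¹ * δ < 1#)
        where

        h≈-Ne : h δ ≈ - (N * e)
        h≈-Ne = begin
          h δ                            ≈⟨ *-identityˡ _ ⟨
          1# * h δ                       ≈⟨ *-congʳ Nδ≈1 ⟨
          N * δ * h δ                    ≈⟨ solve 4 (λ n x h e → n :* x :* h := n :* (e :+ x :* h) :- n :* e) refl N δ (h δ) e ⟩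
          N * (e + δ * h δ) - N * e      ≈⟨ +-congʳ (*-congˡ (trans (sym (f≈ δ)) (f≈0 δ 0<δ))) ⟩
          N * 0# - N * e                 ≈⟨ +-congʳ (zeroʳ N) ⟩
          0# - N * e                     ≈⟨ +-identityˡ _ ⟩
          - (N * e)                      ∎

        Ne≤K : N * e ≤ K
        Ne≤K = 0≤y-x⇒x≤y (≤-resp-≈ refl (+-congˡ h≈-Ne) (proj₂ (bound δ (<⇒≤ 0<δ) δ≤1)))

        K<Ne : K < N * e
        K<Ne = <-resp-≈
          (begin
            K * e⁻¹ * δ * (N * e)      ≈⟨ solve 5 (λ k i d n e → k :* i :* d :* (n :* e) := k :* (e :* i) :* (n :* d)) refl K e⁻¹ δ N e ⟩
            K * (e * e⁻¹) * (N * δ)    ≈⟨ *-cong (*-congˡ (*-inverse e (>⇒# 0<f0))) Nδ≈1 ⟩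
            K * 1# * 1#                ≈⟨ trans (*-identityʳ _) (*-identityʳ K) ⟩
            K                          ∎)
          (*-identityˡ _)
          (*-monoʳ-< (N * e) (*-pos 0<N 0<f0) Ke⁻¹δ<1)

      -- At `δ = 1/N`, the equation `f δ = 0` gives `h δ = - N e`, which is below `- K` once `N`
      -- exceeds `K/e`.
      contradictory : ⊥
      contradictory =
        let (k , δ , 0<δ , δ≤1 , Nδ≈1 , Ke⁻¹δ<1) = small-reciprocal (K * e⁻¹)
            0<N = <-≤-trans 0<1 (≤-+ refl (0≤n·1 k))
        in Ne≤K (suc k · 1#) δ 0<N 0<δ δ≤1 Nδ≈1 Ke⁻¹δ<1 (K<Ne (suc k · 1#) δ 0<N 0<δ δ≤1 Nδ≈1 Ke⁻¹δ<1)

    -- Near 0 a polynomial is f 0 + x h x with h bounded.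
    vanishes⇒≤0 : ∀ {f} → Poly f → (∀ x → 0# < x → f x ≈ 0#) → f 0# ≤ 0#
    vanishes⇒≤0 F f≈0 0<f0 =
      let (h , H , f≈) = quotient F
          (K , bound)  = bounded H
      in contradictory f≈ bound f≈0 0<f0

  vanishes⇒≈0 : ∀ {f} → Poly f → (∀ x → 0# < x → f x ≈ 0#) → f 0# ≈ 0#
  vanishes⇒≈0 {f} F f≈0 = ≤-antisym (vanishes⇒≤0 F f≈0)
    (≤-resp-≈ -0#≈0# (solve 1 (λ x → :- (:- con (+ 1) :* x) := x) refl (f 0#))
      (neg-mono-≤ (vanishes⇒≤0 (-ᵖ F) λ x 0<x → trans (*-congˡ (f≈0 x 0<x)) (zeroʳ _))))

-- Laplacians, energies and complements.

module Graphs {c ℓ₁ ℓ₂} (ℝ : RealNumbers c ℓ₁ ℓ₂) where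
  open OrderedField ℝ
  open Sums ℝ
  open QuadraticInequalities ℝ using (2#)
  open HubBounds ℝ using (∑²; Dominates; Bound)
  open Extremes ℝ using (bound-either)
  open Determinant ℝ
  open Polynomial ℝ
  open Laplacian ℝ
  open import Relation.Binary.Reasoning.Setoid setoid

  private
    variable
      n : ℕ

  module _ {p} {P : Set p} where
    indicator-yes : (P? : Dec P) → P → indicator P? ≈ 1#
    indicator-yes P? p = reflexive (≡.cong (if_then 1# else 0#) (dec-true P? p))

    indicator-no : (P? : Dec P) → ¬ P → indicator P? ≈ 0#
    indicator-no P? ¬p = reflexive (≡.cong (if_then 1# else 0#) (dec-false P? ¬p))

    0≤indicator : (P? : Dec P) → 0# ≤ indicator P?
    0≤indicator (yes _) = 0≤1
    0≤indicator (no  _) = ≤-refl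

  sum-identity : (f : Vector Carrier n) (i : Fin n) → sum (λ j → identity i j * f j) ≈ f i
  sum-identity {suc n} f zero = trans (+-cong (*-identityˡ _) (sum-zero {n} (λ j → zeroˡ _))) (+-identityʳ _)
  sum-identity {suc n} f (suc i) = trans (+-cong (zeroˡ _) (sum-identity (f ∘ suc) i)) (+-identityˡ _)

  identity-symm : (i j : Fin n) → identity i j ≡ identity j i
  identity-symm zero    zero    = ≡.refl
  identity-symm zero    (suc j) = ≡.refl
  identity-symm (suc i) zero    = ≡.refl
  identity-symm (suc i) (suc j) = identity-symm i j

  -- The general `f` makes the induction on a tabulated list possible; `allFin` is the case of the
  -- identity.
  length-filter : ∀ {p} {P : Fin n → Set p} (P? : ∀ i → Dec (P i)) {m} (f : Fin m → Fin n) →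
                  length (filter P? (List.tabulate f)) · 1# ≈ sum (λ i → indicator (P? (f i)))
  length-filter P? {zero}  f = refl
  length-filter P? {suc m} f with P? (f zero)
  ... | yes _ = +-congˡ (length-filter P? (f ∘ suc))
  ... | no  _ = trans (length-filter P? (f ∘ suc)) (sym (+-identityˡ _))

  module _ (G : Graph n) where
    open Graph G using (_~_; _~?_; degree) renaming (sym to ~-sym)

    A : Matrix n
    A = adjacencyMatrix G

    A-symm : ∀ i j → A i j ≈ A j i
    A-symm i j with i ~? j
    ... | yes i~j = sym (indicator-yes (j ~? i) (~-sym i~j))
    ... | no  i≁j = sym (indicator-no (j ~? i) (i≁j ∘ ~-sym))

    degree≈∑A : ∀ i → degree i · 1# ≈ sum (A i)
    degree≈∑A i = length-filter (i ~?_) id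

    laplacian≈ : ∀ i j → laplacian G i j ≈ sum (A i) * identity i j - A i j
    laplacian≈ i j = +-congʳ (begin
      degree i · identity i j         ≈⟨ ×-congʳ (degree i) (*-identityˡ _) ⟨
      degree i · (1# * identity i j)  ≈⟨ ×-assoc-* (degree i) 1# _ ⟨
      (degree i · 1#) * identity i j  ≈⟨ *-congʳ (degree≈∑A i) ⟩
      sum (A i) * identity i j        ∎)

    laplacian-symm : ∀ i j → laplacian G i j ≈ laplacian G j i
    laplacian-symm i j = begin
      laplacian G i j                   ≈⟨ laplacian≈ i j ⟩
      sum (A i) * identity i j - A i j  ≈⟨ +-cong diagonal (-‿cong (A-symm i j)) ⟩
      sum (A j) * identity j i - A j i  ≈⟨ laplacian≈ j i ⟨
      laplacian G j i                   ∎
      where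
      diagonal : sum (A i) * identity i j ≈ sum (A j) * identity j i
      diagonal with i Fin.≟ j
      ... | yes ≡.refl = *-congˡ (sym (indicator-yes (i Fin.≟ i) ≡.refl))
      ... | no  i≢j    = trans (zeroʳ _) (sym (trans (*-congˡ (indicator-no (j Fin.≟ i) (i≢j ∘ ≡.sym))) (zeroʳ _)))

    differences : Vector Carrier n → Vector Carrier n
    differences p i = sum (λ j → A i j * (p i - p j))

    laplacian∙ : (p : Vector Carrier n) (i : Fin n) → laplacian G i ∙ p ≈ differences p i
    laplacian∙ p i = begin
      sum (λ j → laplacian G i j * p j)
        ≈⟨ sum-cong-≋ {n} (λ j → trans (*-congʳ (laplacian≈ i j))
             (solve 4 (λ d e a p → (d :* e :- a) :* p := d :* (e :* p) :- a :* p) refl (sum (A i)) (identity i j) (A i j) (p j))) ⟩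
      sum (λ j → sum (A i) * (identity i j * p j) - A i j * p j)
        ≈⟨ ∑-distrib-- (λ j → sum (A i) * (identity i j * p j)) (λ j → A i j * p j) ⟩
      sum (λ j → sum (A i) * (identity i j * p j)) - sum (λ j → A i j * p j)
        ≈⟨ +-congʳ (trans (sym (*-distribˡ-sum (sum (A i)) (λ j → identity i j * p j)))
             (trans (*-congˡ (sum-identity p i)) (*-distribʳ-sum (p i) (A i)))) ⟩
      sum (λ j → A i j * p i) - sum (λ j → A i j * p j)
        ≈⟨ ∑-distrib-- (λ j → A i j * p i) (λ j → A i j * p j) ⟨
      sum (λ j → A i j * p i - A i j * p j)
        ≈⟨ sum-cong-≋ {n} (λ j → solve 3 (λ a p q → a :* p :- a :* q := a :* (p :- q)) refl (A i j) (p i) (p j)) ⟩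
      differences p i ∎

    Eigenvector : Carrier → Vector Carrier n → Set ℓ₁
    Eigenvector a p = ∀ i → differences p i ≈ a * p i

    -- Twice the quadratic form of the Laplacian, since each pair is summed in both orders.
    energy : Vector Carrier n → Carrier
    energy p = sum (λ i → sum (λ j → A i j * (p j - p i) ²))

    -- Each term splits into a part multiplied by `p i` and a part multiplied by `p j`; by the
    -- symmetry of `A` both have the same sum, which is `a ∑ p²`.
    energy≈2a∑² : ∀ {a p} → Eigenvector a p → energy p ≈ 2# * (a * ∑² p)
    energy≈2a∑² {a} {p} eigen = begin
      energy p
        ≈⟨ sum-cong-≋ {n} (λ i → trans (sum-cong-≋ {n} (λ j →
             solve 3 (λ a p q → a :* ((q :- p) :* (q :- p)) := p :* (a :* (p :- q)) :+ a :* (q :- p) :* q) refl (A i j) (p i) (p j)))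
             (∑-distrib-+ (λ j → p i * (A i j * (p i - p j))) (λ j → A i j * (p j - p i) * p j))) ⟩
      sum (λ i → sum (λ j → p i * (A i j * (p i - p j))) + sum (λ j → A i j * (p j - p i) * p j))
        ≈⟨ ∑-distrib-+ (λ i → sum (λ j → p i * (A i j * (p i - p j)))) (λ i → sum (λ j → A i j * (p j - p i) * p j)) ⟩
      sum (λ i → sum (λ j → p i * (A i j * (p i - p j)))) + sum (λ i → sum (λ j → A i j * (p j - p i) * p j))
        ≈⟨ +-congˡ (trans (∑-comm (λ i j → A i j * (p j - p i) * p j))
             (sum-cong-≋ {n} (λ i → sum-cong-≋ {n} (λ j → trans (*-comm _ _) (*-congˡ (*-congʳ (A-symm j i))))))) ⟩
      sum (λ i → sum (λ j → p i * (A i j * (p i - p j)))) + sum (λ i → sum (λ j → p i * (A i j * (p i - p j))))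
        ≈⟨ double _ ⟨
      2# * sum (λ i → sum (λ j → p i * (A i j * (p i - p j))))
        ≈⟨ *-congˡ (sum-cong-≋ {n} (λ i → trans (sym (*-distribˡ-sum (p i) (λ j → A i j * (p i - p j))))
             (trans (*-congˡ (eigen i)) (solve 2 (λ p a → p :* (a :* p) := a :* (p :* p)) refl (p i) a)))) ⟩
      2# * sum (λ i → a * p i ²)
        ≈⟨ *-congˡ (*-distribˡ-sum a (λ i → p i ²)) ⟨
      2# * (a * ∑² p) ∎

    0≤energy : ∀ p → 0# ≤ energy p
    0≤energy p = 0≤sum {n} λ i → 0≤sum {n} λ j → 0≤indicator (i ~? j) ⊛ 0≤x² _

  0<∑² : (p : Vector Carrier n) (k : Fin n) → p k # 0# → 0# < ∑² p
  0<∑² p k pk#0 = <-≤-trans (0<x² (#⇒<⊎> pk#0))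
    (≤-resp-≈ (+-identityʳ _) refl (sumOver-≤-sum {xs = k ∷ []} {f = λ i → p i ²} ([] ∷ []) (λ i → 0≤x² (p i))))
    where
    0<x² : ∀ {x} → x < 0# ⊎ 0# < x → 0# < x ²
    0<x² {x} (inj₁ x<0) = <-resp-≈ refl (solve 1 (λ x → (con (+ 0) :- x) :* (con (+ 0) :- x) := x :* x) refl x)
      (*-pos (x<y⇒0<y-x x<0) (x<y⇒0<y-x x<0))
    0<x² (inj₂ 0<x) = *-pos 0<x 0<x

  -- The energy is nonnegative and equals `2 a ∑ p²`, with `∑ p²` positive.
  eigenvalue-nonneg : (G : Graph n) → ∀ {a} p k → p k # 0# → Eigenvector G a p → 0# ≤ a
  eigenvalue-nonneg G {a} p k pk#0 eigen = *-cancelˡ-≤ (∑² p) (0<∑² p k pk#0)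
    (≤-resp-≈ (sym (zeroʳ _)) (*-comm _ _) (0≤-half (sym (energy≈2a∑² G eigen)) (0≤energy G p)))

  module _ (G : Graph n) where
    open Graph G using (_~_; _~?_) renaming (sym to ~-sym)

    private
      Ḡ : Graph n
      Ḡ = complement G

    A-edge : ∀ {i j} → i ~ j → A G i j ≈ 1#
    A-edge {i} {j} i~j = indicator-yes (i ~? j) i~j

    A-nonedge : ∀ {i j} → ¬ (i ~ j) → A G i j ≈ 0#
    A-nonedge {i} {j} i≁j = indicator-no (i ~? j) i≁j

    Ā-edge : ∀ {i j} → i ~ j → A Ḡ i j ≈ 0#
    Ā-edge {i} {j} i~j = indicator-no (Graph._~?_ Ḡ i j) λ (_ , i≁j) → i≁j i~j

    Ā-nonedge : ∀ {i j} → i ≢ j → ¬ (i ~ j) → A Ḡ i j ≈ 1#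
    Ā-nonedge {i} {j} i≢j i≁j = indicator-yes (Graph._~?_ Ḡ i j) (i≢j , i≁j)

    A+Ā : ∀ (p : Vector Carrier n) i j → A G i j * (p i - p j) + A Ḡ i j * (p i - p j) ≈ p i - p j
    A+Ā p i j = cases (i Fin.≟ j) (i ~? j)
      where
      cases : Dec (i ≡ j) → Dec (i ~ j) → A G i j * (p i - p j) + A Ḡ i j * (p i - p j) ≈ p i - p j
      cases (yes ≡.refl) _       = trans (sym (distribʳ _ _ _))
                                     (trans (*-congˡ (-‿inverseʳ (p i))) (trans (zeroʳ _) (sym (-‿inverseʳ (p i)))))
      cases (no i≢j)   (yes i~j) = trans (+-cong (*-congʳ (A-edge i~j)) (*-congʳ (Ā-edge i~j)))
                                     (trans (+-cong (*-identityˡ _) (zeroˡ _)) (+-identityʳ _))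
      cases (no i≢j)   (no i≁j)  = trans (+-cong (*-congʳ (A-nonedge i≁j)) (*-congʳ (Ā-nonedge i≢j i≁j)))
                                     (trans (+-cong (zeroˡ _) (*-identityˡ _)) (+-identityˡ _))

    -- The two Laplacians add up to `n I - J` with `J` the all-ones matrix, and `J p = 0`.
    eigenvector-complement : ∀ {a p} → sum p ≈ 0# → Eigenvector G a p → Eigenvector Ḡ (n · 1# - a) p
    eigenvector-complement {a} {p} ∑p≈0 eigen i = begin
      D̄
        ≈⟨ solve 2 (λ d e → e := d :+ e :- d) refl D D̄ ⟩
      D + D̄ - D
        ≈⟨ +-cong (trans (sym (∑-distrib-+ (λ j → A G i j * (p i - p j)) (λ j → A Ḡ i j * (p i - p j))))
             (sum-cong-≋ {n} (A+Ā p i))) (-‿cong (eigen i)) ⟩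
      sum (λ j → p i - p j) - a * p i
        ≈⟨ +-congʳ (trans (∑-distrib-- (λ _ → p i) p) (+-cong (sum-replicate n) (-‿cong ∑p≈0))) ⟩
      (n · p i - 0#) - a * p i
        ≈⟨ +-congʳ (trans (x-0≈x _) (trans (×-congʳ n (sym (*-identityˡ _))) (sym (×-assoc-* n 1# (p i))))) ⟩
      (n · 1#) * p i - a * p i
        ≈⟨ solve 3 (λ m a p → m :* p :- a :* p := (m :- a) :* p) refl (n · 1#) a (p i) ⟩
      (n · 1# - a) * p i ∎
      where
      D D̄ : Carrier
      D  = differences G p i
      D̄ = differences Ḡ p i

    mixed : (p q : Vector Carrier n) → Fin n → Fin n → Carrier
    mixed p q i j = A G i j * (p j - p i) ² + A Ḡ i j * (q j - q i) ²

    -- Two distinct vertices are adjacent in exactly one of the two graphs, so their entry of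
    -- `mixed` is one of the two squares.
    mixed-dominates : ∀ p q → Dominates (mixed p q) p q
    mixed-dominates p q = record
      { nonneg = λ i j → 0≤indicator (i ~? j) ⊛ 0≤x² _ ⊹ 0≤indicator (Graph._~?_ Ḡ i j) ⊛ 0≤x² _
      ; symm   = λ i j → +-cong (*-cong (A-symm G i j) ([x-y]²≈[y-x]² _ _)) (*-cong (A-symm Ḡ i j) ([x-y]²≈[y-x]² _ _))
      ; edge   = edge
      }
      where
      edge : ∀ i j → (p j - p i) ² ≤ mixed p q i j ⊎ (q j - q i) ² ≤ mixed p q i j
      edge i j = cases (i Fin.≟ j) (i ~? j)
        where
        cases : Dec (i ≡ j) → Dec (i ~ j) → (p j - p i) ² ≤ mixed p q i j ⊎ (q j - q i) ² ≤ mixed p q i j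
        cases (yes ≡.refl) _       = inj₁ (≤-resp-≈ (sym (x≈y⇒[x-y]²≈0 refl)) refl
          (0≤indicator (i ~? i) ⊛ 0≤x² _ ⊹ 0≤indicator (Graph._~?_ Ḡ i i) ⊛ 0≤x² _))
        cases (no i≢j)   (yes i~j) = inj₁ (≤-reflexive (sym (trans (+-cong (*-congʳ (A-edge i~j)) (*-congʳ (Ā-edge i~j)))
                                       (trans (+-cong (*-identityˡ _) (zeroˡ _)) (+-identityʳ _)))))
        cases (no i≢j)   (no i≁j)  = inj₂ (≤-reflexive (sym (trans (+-cong (*-congʳ (A-nonedge i≁j)) (*-congʳ (Ā-nonedge i≢j i≁j)))
                                       (trans (+-cong (zeroˡ _) (*-identityˡ _)) (+-identityˡ _)))))

    ∑∑mixed≈ : ∀ p q → sum (λ i → sum (mixed p q i)) ≈ energy G p + energy Ḡ q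
    ∑∑mixed≈ p q = trans
      (sum-cong-≋ {n} (λ i → ∑-distrib-+ (λ j → A G i j * (p j - p i) ²) (λ j → A Ḡ i j * (q j - q i) ²)))
      (∑-distrib-+ (λ i → sum (λ j → A G i j * (p j - p i) ²)) (λ i → sum (λ j → A Ḡ i j * (q j - q i) ²)))

  -- The double sum of `mixed` is the sum of the two energies, that is `2 (a ∑ p² + b ∑ q²)`, and
  -- `bound-either` applies to it.
  some-∑²-bounded : ∀ {ℓ} {C : Set ℓ} {m} (G : Graph (suc m)) {a b} (p q : Vector Carrier (suc m)) →
    Eigenvector G a p → Eigenvector (complement G) b q → sum p ≈ 0# → sum q ≈ 0# →
    (∑² p ≤ a * ∑² p + b * ∑² q → ¬ C) → (∑² q ≤ a * ∑² p + b * ∑² q → ¬ C) → ¬ C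
  some-∑²-bounded G {a} {b} p q eigen-p eigen-q ∑p≈0 ∑q≈0 k-p k-q =
    bound-either (mixed-dominates G p q) ∑p≈0 ∑q≈0 (k-p ∘ halved {p}) (k-q ∘ halved {q})
    where
    halved : ∀ {f : Vector Carrier _} → Bound (mixed G p q) f → ∑² f ≤ a * ∑² p + b * ∑² q
    halved bound = *-cancelˡ-≤ 2# 0<2 (≤-resp-≈ refl
      (trans (∑∑mixed≈ G p q) (trans
        (+-cong (energy≈2a∑² G eigen-p) (energy≈2a∑² (complement G) eigen-q)) (sym (distribˡ 2# _ _)))) bound)

  eigenvector-scale : (G : Graph n) {a : Carrier} {p : Vector Carrier n} (s : Carrier) →
                      Eigenvector G a p → Eigenvector G a (λ i → s * p i)
  eigenvector-scale {n} G {a} {p} s eigen i = begin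
    sum (λ j → A G i j * (s * p i - s * p j))
      ≈⟨ sum-cong-≋ {n} (λ j → solve 4 (λ a s p q → a :* (s :* p :- s :* q) := s :* (a :* (p :- q))) refl (A G i j) s (p i) (p j)) ⟩
    sum (λ j → s * (A G i j * (p i - p j)))
      ≈⟨ *-distribˡ-sum s (λ j → A G i j * (p i - p j)) ⟨
    s * differences G p i
      ≈⟨ *-congˡ (eigen i) ⟩
    s * (a * p i)
      ≈⟨ solve 3 (λ s a p → s :* (a :* p) := a :* (s :* p)) refl s a (p i) ⟩
    a * (s * p i) ∎

  ∑²-scale : (s : Carrier) (p : Vector Carrier n) → ∑² (λ i → s * p i) ≈ s ² * ∑² p
  ∑²-scale {n} s p = trans
    (sum-cong-≋ {n} (λ i → solve 2 (λ s p → (s :* p) :* (s :* p) := s :* s :* (p :* p)) refl s (p i)))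
    (sym (*-distribˡ-sum (s ²) (λ i → p i ²)))

  private
    module _ {x y : Carrier} (0≤x : 0# ≤ x) (x<y : x < y) (avoid : ∀ s → x < s ² → ¬ (s ² < y)) where

      η η⁻¹ z : Carrier
      η = y - x
      η⁻¹ = η ⁻¹⟨ >⇒# (x<y⇒0<y-x x<y) ⟩
      -- For `0 < δ ≤ 1` and `t ≤ x + 1`, the increment `(t + δ)² - t²` is at most `(2x + 3) δ`; the
      -- bound on `t` follows from `t² ≤ x`.
      z = x + x + 1# + 1# + 1#

      0<η : 0# < η
      0<η = x<y⇒0<y-x x<y

      x<t² : ∀ {t} → x + 1# < t → x < t ²
      x<t² {t} x+1<t = <-≤-trans (<-resp-≈ (+-identityˡ x) refl (+-monoˡ-< x 0<1))
        (≤-+ (solve 2 (λ x t → let d = t :- (x :+ con (+ 1)) in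
               t :* t := con (+ 1) :+ x :+ (d :* d :+ (con (+ 1) :+ con (+ 1)) :* (d :* (x :+ con (+ 1))) :+ (x :* x :+ x))) refl x t)
             (0≤x² _ ⊹ 0≤2 ⊛ (x≤y⇒0≤y-x (<⇒≤ x+1<t) ⊛ (0≤x ⊹ 0≤1)) ⊹ (0≤x² x ⊹ 0≤x)))

      -- The multiples of a small enough δ cannot jump over the interval.
      module _ (δ : Carrier) (0<δ : 0# < δ) (δ≤1 : δ ≤ 1#) (zη⁻¹δ<1 : z * η⁻¹ * δ < 1#) where

        x+zδ<y : x + z * δ < y
        x+zδ<y = <-resp-≈ (+-comm _ _) (solve 2 (λ x y → y :- x :+ x := y) refl x y)
          (+-monoˡ-< x (<-resp-≈
            (trans (solve 4 (λ z h d e → z :* h :* d :* e := z :* d :* (e :* h)) refl z η⁻¹ δ η)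
              (trans (*-congˡ (*-inverse η (>⇒# 0<η))) (*-identityʳ _)))
            (*-identityˡ η) (*-monoʳ-< η 0<η zη⁻¹δ<1)))

        multiple²≤x : ∀ j → (j · 1# * δ) ² ≤ x
        multiple²≤x zero    = ≤-resp-≈ (sym (trans (*-congʳ (zeroˡ δ)) (zeroˡ _))) refl 0≤x
        multiple²≤x (suc j) x<s² = avoid (suc j · 1# * δ) x<s² (≤-<-trans
          (≤-+ (solve 3 (λ x d k → let t = k :* d ; one = con (+ 1) in
                 x :+ (x :+ x :+ one :+ one :+ one) :* d := ((one :+ k) :* d) :* ((one :+ k) :* d) :+
                 (x :- t :* t :+ d :* (x :+ one :- t :+ (x :+ one :- t) :+ (one :- d)))) refl x δ (j · 1#))
               (x≤y⇒0≤y-x (multiple²≤x j) ⊹ <⇒≤ 0<δ ⊛ (0≤x+1-t ⊹ 0≤x+1-t ⊹ x≤y⇒0≤y-x δ≤1)))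
          x+zδ<y)
          where
          0≤x+1-t : 0# ≤ x + 1# - j · 1# * δ
          0≤x+1-t = x≤y⇒0≤y-x λ x+1<t → multiple²≤x j (x<t² x+1<t)

  -- Takes the place of a square root in the scaling argument. If no square lies strictly between
  -- `x` and `y`, the squares of all multiples of a small `δ` stay at most `x`, against the
  -- Archimedean axiom.
  square-between : ∀ {x y} → 0# ≤ x → x < y → ¬ (∀ s → x < s ² → ¬ (s ² < y))
  square-between {x} 0≤x x<y avoid =
    let (m , x+1<m)                                = archimedean (x + 1#)
        (k , δ , 0<δ , δ≤1 , Nδ≈1 , zη⁻¹δ<1) = small-reciprocal (z 0≤x x<y avoid * η⁻¹ 0≤x x<y avoid)
        -- Since `δ = 1/(k+1)`, the number `m` is itself a multiple of `δ`.
        m≈ = trans (sym (*-identityʳ _)) (trans (*-congˡ (sym Nδ≈1))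
               (trans (sym (*-assoc _ _ _)) (*-congʳ (sym (×1-homo-* m (suc k))))))
    in multiple²≤x 0≤x x<y avoid δ 0<δ δ≤1 zη⁻¹δ<1 (m ℕ.* suc k)
         (<-resp-≈ refl (²-cong m≈) (x<t² 0≤x x<y avoid x+1<m))

-- Centred eigenvectors from the spectrum.

module Spectra {c ℓ₁ ℓ₂} (ℝ : RealNumbers c ℓ₁ ℓ₂) where
  open OrderedField ℝ
  open Sums ℝ
  open HubBounds ℝ using (∑²)
  open Determinant ℝ
  open Polynomial ℝ
  open Graphs ℝ
  open Laplacian ℝ
  open import Relation.Binary.Reasoning.Setoid setoid

  private
    variable
      n : ℕ

  Nonzero : Vector Carrier n → Set _
  Nonzero p = ∃[ k ] p k # 0#

  -- With `P = ∑ p²`, `Q = ∑ q²` and `a + b < 1`, scale `p` by some `s` such that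
  -- `bQ/(1 - a) < s² P < Q`. The first inequality makes `a s² P + b Q` less than `s² P`, the second
  -- less than `Q`.
  1≤eigenvalue-sum : (G : Graph (suc n)) {a b : Carrier} (p q : Vector Carrier (suc n)) →
    Nonzero p → Nonzero q → sum p ≈ 0# → sum q ≈ 0# →
    Eigenvector G a p → Eigenvector (complement G) b q → 1# ≤ a + b
  1≤eigenvalue-sum G {a} {b} p q (k , pk#0) (l , ql#0) ∑p≈0 ∑q≈0 eigen-p eigen-q a+b<1 =
    square-between 0≤x x<y λ s x<s² s²<y →
      some-∑²-bounded G (λ i → s * p i) q (eigenvector-scale G s eigen-p) eigen-q
        (trans (sym (*-distribˡ-sum s p)) (trans (*-congˡ ∑p≈0) (zeroʳ s))) ∑q≈0
        (λ sp≤ _ → ≤-resp-≈ (∑²-scale s p) (+-congʳ (*-congˡ (∑²-scale s p))) sp≤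
          (0<y-x⇒x<y (<-resp-≈ refl
            (trans (+-congˡ (-‿cong x*[P[1-a]]≈bQ))
              (solve 5 (λ s P a b Q → s :* (P :* (con (+ 1) :- a)) :- b :* Q := s :* P :- (a :* (s :* P) :+ b :* Q)) refl (s ²) P a b Q))
            (x<y⇒0<y-x (*-monoʳ-< (P * (1# - a)) (*-pos 0<P 0<1-a) x<s²)))))
        (λ q≤ _ → ≤-trans (≤-resp-≈ refl (+-congʳ (*-congˡ (∑²-scale s p))) q≤)
          (≤-trans (+-monoˡ-≤ (b * Q) (*-monoˡ-≤ a 0≤a (<⇒≤ (<-resp-≈ refl yP≈Q (*-monoʳ-< P 0<P s²<y)))))
            (≤-reflexive (sym (distribʳ Q a b))))
          (<-resp-≈ refl (*-identityˡ Q) (*-monoʳ-< Q 0<Q a+b<1)))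
        a+b<1
    where
    P Q : Carrier
    P = ∑² p
    Q = ∑² q
    0<P : 0# < P
    0<P = 0<∑² p k pk#0
    0<Q : 0# < Q
    0<Q = 0<∑² q l ql#0
    0≤a : 0# ≤ a
    0≤a = eigenvalue-nonneg G p k pk#0 eigen-p
    0≤b : 0# ≤ b
    0≤b = eigenvalue-nonneg (complement G) q l ql#0 eigen-q
    0<1-a : 0# < 1# - a
    0<1-a = x<y⇒0<y-x (≤-<-trans (≤-+ refl 0≤b) a+b<1)
    P#0 = >⇒# 0<P
    1-a#0 = >⇒# 0<1-a
    r t x y : Carrier
    r = P ⁻¹⟨ P#0 ⟩
    t = (1# - a) ⁻¹⟨ 1-a#0 ⟩
    x = b * t * (Q * r)
    y = Q * r
    0<t : 0# < t
    0<t = ⁻¹-pos 0<1-a 1-a#0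
    0<y : 0# < y
    0<y = *-pos 0<Q (⁻¹-pos 0<P P#0)
    0≤x : 0# ≤ x
    0≤x = 0≤b ⊛ <⇒≤ 0<t ⊛ <⇒≤ 0<y
    x<y : x < y
    x<y = <-resp-≈ refl (*-identityˡ y) (*-monoʳ-< y 0<y
      (<-resp-≈ refl (*-inverse _ 1-a#0) (*-monoʳ-< t 0<t
        (0<y-x⇒x<y (<-resp-≈ refl (solve 2 (λ a b → con (+ 1) :- (a :+ b) := con (+ 1) :- a :- b) refl a b)
          (x<y⇒0<y-x a+b<1))))))
    yP≈Q : y * P ≈ Q
    yP≈Q = trans (*-assoc _ _ _) (trans (*-congˡ (trans (*-comm _ _) (*-inverse P P#0))) (*-identityʳ Q))
    x*[P[1-a]]≈bQ : x * (P * (1# - a)) ≈ b * Q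
    x*[P[1-a]]≈bQ = begin
      b * t * (Q * r) * (P * (1# - a))   ≈⟨ solve 6 (λ b t Q r P d → b :* t :* (Q :* r) :* (P :* d) := b :* Q :* ((P :* r) :* (d :* t))) refl b t Q r P (1# - a) ⟩
      b * Q * ((P * r) * ((1# - a) * t)) ≈⟨ *-congˡ (*-cong (*-inverse P P#0) (*-inverse _ 1-a#0)) ⟩
      b * Q * (1# * 1#)                  ≈⟨ trans (*-congˡ (*-identityˡ 1#)) (*-identityʳ _) ⟩
      b * Q                              ∎

  module _ (G : Graph (suc n)) where

    characteristic : Carrier → Matrix (suc n)
    characteristic x i j = x * identity i j - laplacian G i j

    reduced : Carrier → Carrier
    reduced x = sum (cofactor (tail (characteristic x)))

    reduced-cong : ∀ {x y} → x ≈ y → reduced x ≈ reduced y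
    reduced-cong {x} {y} x≈y = sum-cong-≋ {suc n} λ j → *-congˡ {x = -1^ toℕ j} (det-cong
      {M = minor (tail (characteristic x)) j} {N = minor (tail (characteristic y)) j} λ i k →
      +-congʳ {x = - laplacian G (suc i) (Fin.punchIn j k)} (*-congʳ {x = identity (suc i) (Fin.punchIn j k)} x≈y))

    reducedᵖ : Poly reduced
    reducedᵖ = sumᵖ λ j → constᵖ (-1^ toℕ j) *ᵖ
      detᵖ (λ i k → (idᵖ *ᵖ constᵖ (identity (suc i) (Fin.punchIn j k))) +ᵖ constᵖ (- laplacian G (suc i) (Fin.punchIn j k)))

    column-sum : ∀ x j → sum (λ i → characteristic x i j) ≈ x
    column-sum x j = begin
      sum (λ i → x * identity i j - laplacian G i j)
        ≈⟨ ∑-distrib-- (λ i → x * identity i j) (λ i → laplacian G i j) ⟩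
      sum (λ i → x * identity i j) - sum (λ i → laplacian G i j)
        ≈⟨ +-cong (trans (sum-cong-≋ {suc n} (λ i → trans (*-comm x (identity i j)) (*-congʳ {x = x} (reflexive (identity-symm i j)))))
             (sum-identity (λ _ → x) j)) (-‿cong laplacian-sum) ⟩
      x - 0#
        ≈⟨ x-0≈x x ⟩
      x ∎
      where
      laplacian-sum : sum (λ i → laplacian G i j) ≈ 0#
      laplacian-sum = begin
        sum (λ i → laplacian G i j)          ≈⟨ sum-cong-≋ {suc n} (λ i → trans (laplacian-symm G i j) (sym (*-identityʳ _))) ⟩
        laplacian G j ∙ (λ _ → 1#)           ≈⟨ laplacian∙ G (λ _ → 1#) j ⟩
        differences G (λ _ → 1#) j           ≈⟨ sum-zero {suc n} (λ i → trans (*-congˡ {x = A G j i} (-‿inverseʳ 1#)) (zeroʳ (A G j i))) ⟩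
        0#                                   ∎

    charPoly≈x*reduced : ∀ x → charPoly (laplacian G) x ≈ x * reduced x
    charPoly≈x*reduced x = det-constant-column-sums (characteristic x) x (column-sum x)

    characteristic∙ : ∀ x p i → characteristic x i ∙ p ≈ x * p i - differences G p i
    characteristic∙ x p i = begin
      sum (λ j → (x * identity i j - laplacian G i j) * p j)
        ≈⟨ sum-cong-≋ {suc n} (λ j → solve 4 (λ x e l p → (x :* e :- l) :* p := x :* (e :* p) :- l :* p) refl
             x (identity i j) (laplacian G i j) (p j)) ⟩
      sum (λ j → x * (identity i j * p j) - laplacian G i j * p j)
        ≈⟨ ∑-distrib-- (λ j → x * (identity i j * p j)) (λ j → laplacian G i j * p j) ⟩
      sum (λ j → x * (identity i j * p j)) - laplacian G i ∙ p
        ≈⟨ +-cong (trans (sym (*-distribˡ-sum x (λ j → identity i j * p j))) (*-congˡ (sum-identity p i))) (-‿cong (laplacian∙ G p i)) ⟩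
      x * p i - differences G p i ∎

    Centred : Carrier → Vector Carrier (suc n) → Set _
    Centred a p = Nonzero p × sum p ≈ 0# × Eigenvector G a p

    -- A null vector of the matrix with the row of ones is orthogonal to that row, which gives the
    -- zero sum, and satisfies every equation of `characteristic a` after the first.
    root⇒eigenvector : ∀ {ℓ} {C : Set ℓ} {a} → reduced a ≈ 0# → (∀ p → Centred a p → ¬ C) → ¬ C
    root⇒eigenvector {a = a} root found = null-vector ((λ _ → 1#) ∷ᵛ tail (characteristic a))
      (trans (det≈row∙cofactor ((λ _ → 1#) ∷ᵛ tail (characteristic a)))
        (trans (sum-cong-≋ {suc n} {λ j → 1# * cofactor (tail (characteristic a)) j} (λ j → *-identityˡ _)) root))
      λ p k pk#0 null → found p ((k , pk#0) , ∑≈0 p null , eigen p null)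
      where
      module _ (p : Vector Carrier (suc n)) (null : ∀ i → ((λ _ → 1#) ∷ᵛ tail (characteristic a)) i ∙ p ≈ 0#) where
        ∑≈0 : sum p ≈ 0#
        ∑≈0 = trans (sum-cong-≋ {suc n} {p} {λ j → 1# * p j} (λ j → sym (*-identityˡ _))) (null zero)
        rows : Vector Carrier (suc n)
        rows i = characteristic a i ∙ p
        rows≈0 : ∀ i → rows i ≈ 0#
        rows≈0 (suc i) = null (suc i)
        -- The replaced row is recovered from the column sums: all rows together give `a ∑ p = 0`.
        rows≈0 zero    = begin
          rows zero                                             ≈⟨ +-identityʳ _ ⟨
          rows zero + 0#                                        ≈⟨ +-congˡ (sum-zero {n} (λ i → null (suc i))) ⟨
          sum rows                                              ≈⟨ ∑-comm (λ i j → characteristic a i j * p j) ⟩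
          sum (λ j → sum (λ i → characteristic a i j * p j))
            ≈⟨ sum-cong-≋ {suc n} (λ j → trans (sym (*-distribʳ-sum (p j) (λ i → characteristic a i j))) (*-congʳ (column-sum a j))) ⟩
          sum (λ j → a * p j)                                   ≈⟨ *-distribˡ-sum a p ⟨
          a * sum p                                             ≈⟨ *-congˡ ∑≈0 ⟩
          a * 0#                                                ≈⟨ zeroʳ a ⟩
          0#                                                    ∎
        eigen : Eigenvector G a p
        eigen i = begin
          differences G p i                              ≈⟨ solve 2 (λ d x → d := x :- (x :- d)) refl (differences G p i) (a * p i) ⟩
          a * p i - (a * p i - differences G p i)        ≈⟨ +-congˡ (-‿cong (trans (sym (characteristic∙ a p i)) (rows≈0 i))) ⟩
          a * p i - 0#                                   ≈⟨ x-0≈x _ ⟩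
          a * p i                                        ∎

  product-zero : (f : Vector Carrier n) (k : Fin n) → f k ≈ 0# → product f ≈ 0#
  product-zero f zero    f0≈0 = trans (*-congʳ f0≈0) (zeroˡ _)
  product-zero f (suc k) fk≈0 = trans (*-congˡ (product-zero (f ∘ suc) k fk≈0)) (zeroʳ _)

  product-last-two : ∀ m (f : Vector Carrier (suc (suc m))) →
    product f ≈ product (λ i → f (inject₁ (inject₁ i))) * (f (inject₁ (fromℕ m)) * f (fromℕ (suc m)))
  product-last-two zero    f = solve 2 (λ a b → a :* (b :* con (+ 1)) := con (+ 1) :* (a :* b)) refl _ _
  product-last-two (suc m) f = trans (*-congˡ (product-last-two m (f ∘ suc))) (sym (*-assoc _ _ _))

  module _ {G : Graph (suc n)} (S : LaplacianSpectrum G) where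
    open LaplacianSpectrum S

    nonzero-root : ∀ k → μ k # 0# → reduced G (μ k) ≈ 0#
    nonzero-root k μk#0 = *-cancelˡ-0 μk#0 (begin
      μ k * reduced G (μ k)           ≈⟨ charPoly≈x*reduced G (μ k) ⟨
      charPoly (laplacian G) (μ k)    ≈⟨ factorisation (μ k) ⟩
      product (λ i → μ k - μ i)       ≈⟨ product-zero (λ i → μ k - μ i) k (-‿inverseʳ (μ k)) ⟩
      0#                              ∎)

  module _ {m} {G : Graph (suc (suc m))} (S : LaplacianSpectrum G) where
    open LaplacianSpectrum S

    private
      a z : Carrier
      a = μ (inject₁ (fromℕ m))
      z = μ (fromℕ (suc m))

      -- Dividing by x at x ≠ 0 shows that reduced G is x times a polynomial.
      double-root : a ≈ 0# → z ≈ 0# → reduced G 0# ≈ 0#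
      double-root a≈0 z≈0 = begin
        reduced G 0#                          ≈⟨ solve 2 (λ r h → r := r :+ :- con (+ 1) :* (con (+ 0) :* h)) refl (reduced G 0#) (h 0#) ⟩
        reduced G 0# + - 1# * (0# * h 0#)     ≈⟨ vanishes⇒≈0 F F≈0 ⟩
        0#                                    ∎
        where
        h : Carrier → Carrier
        h x = product (λ i → x - μ (inject₁ (inject₁ i)))
        F : Poly (λ x → reduced G x + - 1# * (x * h x))
        F = reducedᵖ G +ᵖ (-ᵖ (idᵖ *ᵖ productᵖ (λ i → idᵖ +ᵖ constᵖ (- μ (inject₁ (inject₁ i))))))
        x-0′ : ∀ {x y} → y ≈ 0# → x - y ≈ x
        x-0′ y≈0 = trans (+-congˡ (-‿cong y≈0)) (x-0≈x _)
        F≈0 : ∀ x → 0# < x → reduced G x + - 1# * (x * h x) ≈ 0#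
        F≈0 x 0<x = *-cancelˡ-0 (>⇒# 0<x) (begin
          x * (reduced G x + - 1# * (x * h x))
            ≈⟨ solve 3 (λ x r h → x :* (r :+ :- con (+ 1) :* (x :* h)) := x :* r :- h :* (x :* x)) refl x (reduced G x) (h x) ⟩
          x * reduced G x - h x * (x * x)
            ≈⟨ +-cong (sym (charPoly≈x*reduced G x)) (-‿cong (*-congˡ (*-cong (sym (x-0′ a≈0)) (sym (x-0′ z≈0))))) ⟩
          charPoly (laplacian G) x - h x * ((x - a) * (x - z))
            ≈⟨ +-congʳ (trans (factorisation x) (product-last-two m (λ i → x - μ i))) ⟩
          h x * ((x - a) * (x - z)) - h x * ((x - a) * (x - z))
            ≈⟨ -‿inverseʳ _ ⟩
          0# ∎)

    -- If `a` is apart from 0, it is a root of `reduced`. If `a` is zero, the least eigenvalue `z`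
    -- is not positive; a `z` apart from 0 would have an eigenvector and thus be nonnegative. So `z`
    -- is zero too, and 0 is still a root after division by `x`.
    second-smallest-eigenvector : ∀ {ℓ} {C : Set ℓ} → (∀ p → Centred G a p → ¬ C) → ¬ C
    second-smallest-eigenvector found = #-≈-cases a 0#
      (λ a#0 → root⇒eigenvector G (nonzero-root S (inject₁ (fromℕ m)) a#0) found)
      (λ a≈0 → #-≈-cases z 0#
        (λ z#0 → root⇒eigenvector G (nonzero-root S (fromℕ (suc m)) z#0) λ p ((k , pk#0) , _ , eigen) _ →
          #-irrefl (≤-antisym (≤-trans z≤a (≤-reflexive a≈0)) (eigenvalue-nonneg G p k pk#0 eigen)) z#0)
        (λ z≈0 → root⇒eigenvector G (trans (reduced-cong G a≈0) (double-root a≈0 z≈0)) found))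
      where
      z≤a : z ≤ a
      z≤a = nonincreasing (Fin.≤fromℕ (inject₁ (fromℕ m)))

    0≤second-smallest : 0# ≤ a
    0≤second-smallest = second-smallest-eigenvector λ p ((k , pk#0) , _ , eigen) →
      eigenvalue-nonneg G p k pk#0 eigen

-- Both inequalities from the eigenvalue estimate.

corollary3p4 : ∀ {c ℓ₁ ℓ₂} (ℝ : RealNumbers c ℓ₁ ℓ₂) →
    let open RealNumbers ℝ
        open Laplacian ℝ in
    (n : ℕ) (2≤n : 2 ℕ.≤ n) (G : Graph n) →
    ((S : LaplacianSpectrum G) (S̄ : LaplacianSpectrum (complement G)) →
       1# ≤ α 2≤n S + α 2≤n S̄)
    ×
    ((S : LaplacianSpectrum G) →
       β 2≤n S - α 2≤n S ≤ (n ∸ 1) · 1#)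
corollary3p4 ℝ (suc (suc m)) 2≤n@(s≤s (s≤s _)) G = sum-bound , spread-bound
  where
  open OrderedField ℝ
  open Laplacian ℝ
  open Graphs ℝ
  open Spectra ℝ

  sum-bound : (S : LaplacianSpectrum G) (S̄ : LaplacianSpectrum (complement G)) →
              1# ≤ α 2≤n S + α 2≤n S̄
  sum-bound S S̄ = second-smallest-eigenvector S λ p (p#0 , ∑p≈0 , eigen-p) →
    second-smallest-eigenvector S̄ λ q (q#0 , ∑q≈0 , eigen-q) →
      1≤eigenvalue-sum G p q p#0 q#0 ∑p≈0 ∑q≈0 eigen-p eigen-q

  -- An eigenvector for `b` is one of the complement for `n - b`, which gives `1 ≤ a + (n - b)`. If
  -- `b` is zero, `nonzero-root` does not apply, but then `b - a` is at most 0.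
  spread-bound : (S : LaplacianSpectrum G) → β 2≤n S - α 2≤n S ≤ suc m · 1#
  spread-bound S = #-≈-cases b 0#
    (λ b#0 → second-smallest-eigenvector S λ p (p#0 , ∑p≈0 , eigen-p) →
      root⇒eigenvector G (nonzero-root S zero b#0) λ q (q#0 , ∑q≈0 , eigen-q) →
      ≤-+ (solve 3 (λ k a b → k := b :- a :+ (a :+ (con (+ 1) :+ k :- b) :- con (+ 1))) refl (suc m · 1#) a b)
        (x≤y⇒0≤y-x (1≤eigenvalue-sum G p q p#0 q#0 ∑p≈0 ∑q≈0 eigen-p (eigenvector-complement G ∑q≈0 eigen-q))))
    (λ b≈0 → ≤-+ (solve 3 (λ k a b → k := b :- a :+ (a :+ (k :- b))) refl (suc m · 1#) a b)
      (0≤second-smallest S ⊹ ≤-resp-≈ refl (sym (trans (+-congˡ (-‿cong b≈0)) (x-0≈x _))) (0≤n·1 (suc m))))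
    where
    a b : Carrier
    a = α 2≤n S
    b = β 2≤n S
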